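{- Let $H$ be a graph with $\chi(H)=3$ that contains a critical edge and has odd girth at least $5$. Then ${\delta_{\text{lin-rem}}}(H)\leq\frac14$.
   Context: Copies of $H$ are labeled copies. For $\varepsilon>0$ and $\gamma\in[0,1]$, $\delta(\varepsilon,H;\gamma)$ is the maximum $\delta\in[0,1]$ such that every $n$-vertex graph with minimum degree at least $\gamma n$ containing $\varepsilon n^2$ edge-disjoint copies of $H$ contains at least $\delta n^{v(H)}$ copies of $H$. ${\delta_{\text{lin-rem}}}(H)$ is the infimum of those $\gamma$ for which there is $\mu=\mu(\gamma)>0$ with $\delta(\varepsilon,H;\gamma)\geq\mu\varepsilon$ for all $\varepsilon>0$. An edge $xy$ of $H$ is critical if $\chi(H-xy)<\chi(H)$. The odd girth is the length of a shortest odd cycle. -}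

module Defs where

open import Data.Bool using (Bool; true; false; _∧_; _∨_; not)
open import Data.Bool.Properties using (∧-comm; ∨-comm)
open import Data.Nat as ℕ using (ℕ; suc; _^_)
open import Data.Fin using (Fin; _≟_)
open import Data.Fin.Properties using ()
open import Data.List using (List; length; filterᵇ; allFin)
open import Data.List.Relation.Unary.AllPairs using (AllPairs)
open import Data.Product using (Σ; ∃; _×_; _,_; proj₁)
open import Data.Integer using (+_)
open import Data.Rational as ℚ using (ℚ; 0ℚ; 1ℚ; _/_; _*_; _≤_; _<_)
open import Function.Definitions using (Injective)
open import Data.Nat.DivMod using (_%_; m%n<n)
open import Relation.Nullary using (¬_; ⌊_⌋)
open import Relation.Binary.PropositionalEquality using (_≡_; _≢_; refl; cong; cong₂; trans)

record Graph (n : ℕ) : Set where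
  field
    adj    : Fin n → Fin n → Bool
    sym    : ∀ a b → adj a b ≡ adj b a
    irrefl : ∀ a → adj a a ≡ false
open Graph public

removeEdge : ∀ {h} → Graph h → Fin h → Fin h → Graph h
removeEdge {h} H x y = record
  { adj = λ a b → adj H a b ∧ not (e a b)
  ; sym = λ a b → cong₂ (λ u v → u ∧ not v) (sym H a b) (e-sym a b)
  ; irrefl = λ a → cong (λ u → u ∧ not (e a a)) (irrefl H a) }
  where
  e : Fin h → Fin h → Bool
  e a b = (⌊ a ≟ x ⌋ ∧ ⌊ b ≟ y ⌋) ∨ (⌊ a ≟ y ⌋ ∧ ⌊ b ≟ x ⌋)
  e-sym : ∀ a b → e a b ≡ e b a
  e-sym a b = trans (∨-comm (⌊ a ≟ x ⌋ ∧ ⌊ b ≟ y ⌋) (⌊ a ≟ y ⌋ ∧ ⌊ b ≟ x ⌋))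
                    (cong₂ _∨_ (∧-comm ⌊ a ≟ y ⌋ ⌊ b ≟ x ⌋) (∧-comm ⌊ a ≟ x ⌋ ⌊ b ≟ y ⌋))

Colourable : ∀ {h} → Graph h → ℕ → Set
Colourable {h} H k = Σ (Fin h → Fin k) λ c → ∀ x y → adj H x y ≡ true → c x ≢ c y

ChromaticNumber≡ : ∀ {h} → Graph h → ℕ → Set
ChromaticNumber≡ H k = Colourable H k × (∀ j → j ℕ.< k → ¬ Colourable H j)

ChromaticNumber< : ∀ {h} → Graph h → ℕ → Set
ChromaticNumber< H k = Σ ℕ λ j → j ℕ.< k × Colourable H j

-- xy is a critical edge of H, where χ(H) = k
HasCriticalEdge : ∀ {h} → Graph h → ℕ → Set
HasCriticalEdge {h} H k = Σ (Fin h) λ x → Σ (Fin h) λ y →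
  adj H x y ≡ true × ChromaticNumber< (removeEdge H x y) k

IsCycle : ∀ {h} → Graph h → (ℓ : ℕ) → .{{_ : ℕ.NonZero ℓ}} → (Fin ℓ → Fin h) → Set
IsCycle H ℓ v = 3 ℕ.≤ ℓ × Injective _≡_ _≡_ v
  × (∀ (i : Fin ℓ) → adj H (v i) (v (Data.Fin.fromℕ< (m%n<n (suc (Data.Fin.toℕ i)) ℓ))) ≡ true)

OddGirth≥ : ∀ {h} → Graph h → ℕ → Set
OddGirth≥ H g = ∀ (m : ℕ) (v : Fin (suc (2 ℕ.* m)) → _) → IsCycle H (suc (2 ℕ.* m)) v → g ℕ.≤ suc (2 ℕ.* m)

Copy : ∀ {h n} → Graph h → Graph n → Set
Copy {h} {n} H G = Σ (Fin h → Fin n) λ f → Injective _≡_ _≡_ f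
  × (∀ x y → adj H x y ≡ true → adj G (f x) (f y) ≡ true)

DistinctCopies : ∀ {h n} {H : Graph h} {G : Graph n} → Copy H G → Copy H G → Set
DistinctCopies {h} (f , _) (g , _) = Σ (Fin h) λ x → f x ≢ g x

EdgeDisjoint : ∀ {h n} {H : Graph h} {G : Graph n} → Copy H G → Copy H G → Set
EdgeDisjoint {H = H} (f , _) (g , _) = ∀ x y x′ y′ → adj H x y ≡ true → adj H x′ y′ ≡ true
  → ¬ (f x ≡ g x′ × f y ≡ g y′)

fromℕ : ℕ → ℚ
fromℕ m = + m / 1

degree : ∀ {n} → Graph n → Fin n → ℕ
degree {n} G v = length (filterᵇ (adj G v) (allFin n))

MinDegree≥ : ∀ {n} → Graph n → ℚ → Set
MinDegree≥ {n} G γ = ∀ v → γ * fromℕ n ≤ fromℕ (degree G v)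

HasEdgeDisjointCopies : ∀ {h n} → Graph h → Graph n → ℚ → Set
HasEdgeDisjointCopies H G t = Σ (List (Copy H G)) λ cs →
  AllPairs (EdgeDisjoint {H = H} {G = G}) cs × t ≤ fromℕ (length cs)

HasCopies : ∀ {h n} → Graph h → Graph n → ℚ → Set
HasCopies H G t = Σ (List (Copy H G)) λ cs →
  AllPairs (DistinctCopies {H = H} {G = G}) cs × t ≤ fromℕ (length cs)

-- γ is admissible in the definition of δ_lin-rem(H): ∃ μ>0 ∀ ε>0, δ(ε,H;γ) ≥ μ ε,
-- written out via the defining property of δ(ε,H;γ).
LinRemAdmissible : ∀ {h} → Graph h → ℚ → Set
LinRemAdmissible {h} H γ = Σ ℚ λ μ → 0ℚ < μ × (∀ (ε : ℚ) → 0ℚ < ε →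
  ∀ (n : ℕ) (G : Graph n) → MinDegree≥ G γ →
  HasEdgeDisjointCopies H G (ε * fromℕ (n ^ 2)) →
  HasCopies H G (μ * ε * fromℕ (n ^ h)))

-- δ_lin-rem(H) ≤ r : the infimum of admissible γ ∈ [0,1] is ≤ r
δlinrem≤ : ∀ {h} → Graph h → ℚ → Set
δlinrem≤ H r = ∀ (s : ℚ) → r < s → Σ ℚ λ γ → 0ℚ ≤ γ × γ ≤ 1ℚ × γ < s × LinRemAdmissible H γ

{-# OPTIONS --safe #-}

-- Let xy be the critical edge, so that H - xy is bipartite with x and y on one side. As H is
-- triangle-free, H maps to a 5-cycle with x and y alone on two adjacent vertices, and even to a
-- 7-cycle in this way if H has no path of length 4 from x to y. By Cauchy–Schwarz (cloning
-- vertices), H is therefore abundant as soon as closed walks of length 5 (resp. 7) are; and the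
-- copies of H with xy placed on an edge ab of G have positive density as soon as the walks of
-- length 4 (resp. 6) from a to b do. Since distinct edge-disjoint copies yield distinct edges ab,
-- it suffices to find, for each copy of H in G, one of these two outcomes.
--
-- The minimum degree exceeds n/4, so among any four vertices two have linearly many common
-- neighbours. Only this and the existence of many neighbours are used, which makes the argument
-- a finite derivation tree independent of G: each node adds a vertex that can be chosen in
-- linearly many ways, and a branch is chosen by pigeonhole. In the derivation every closed walk
-- of odd length at least 9 is shortened, and parities of walks define a 2-colouring. If H has no
-- path of length 4 from x to y, a monochromatic edge of H is the edge ab. Otherwise H contains a
-- 5-cycle. If closed walks of length 7 abound, then the five sets formed by those of their
-- vertices that share many neighbours with a given vertex of the 5-cycle cannot be cyclically
-- disjoint, which gives ab. If not, the colouring is proper up to few edges, one colour class is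
-- such that any two of its vertices have common neighbours, and it meets the neighbourhoods of
-- two consecutive vertices a and b of the 5-cycle.

module Submission where

open import Defs
open import Data.Bool as Bool using (Bool; true; false; not; _xor_; _∧_; _∨_; if_then_else_)
open import Data.Bool.Properties using (not-involutive; ∨-zeroʳ; xor-same; ¬-not)
open import Data.Empty using (⊥; ⊥-elim)
open import Data.Fin as Fin using (Fin; zero; suc; inject₁; toℕ)
open import Data.Fin.Patterns
open import Data.Fin.Properties using (any?; all?; toℕ-fromℕ<; ¬∀⟶∃¬)
import Data.Integer as ℤ
import Data.Integer.Properties as ℤ
open import Data.List using (List; []; _∷_; _++_; map; length; allFin; cartesianProductWith; filterᵇ; filter)
open import Data.List.Membership.Propositional using (_∈_)
open import Data.List.Membership.Propositional.Properties using (∈-allFin; ∈-cartesianProductWith⁺)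
open import Data.List.Properties using (length-tabulate; length-++; length-map)
open import Data.List.Relation.Binary.Subset.Propositional using (_⊆_)
open import Data.List.Relation.Unary.All as All using (All; []; _∷_)
open import Data.List.Relation.Unary.All.Properties using (all-filter)
open import Data.List.Relation.Unary.AllPairs as AllPairs using (AllPairs; []; _∷_)
open import Data.List.Relation.Unary.Any using (here; there)
open import Data.List.Relation.Unary.Unique.Propositional using (Unique)
open import Data.List.Relation.Unary.Unique.Propositional.Properties using (allFin⁺; cartesianProductWith⁺; filter⁺)
open import Data.Maybe using (Maybe; just; nothing)
open import Data.Maybe.Properties using (just-injective)
open import Data.Nat using (ℕ; zero; suc; _+_; _*_; _^_; _≤_; _<_; _⊔_; _≤?_; z≤n; s≤s; NonZero)
import Data.Nat.Coprimality as Coprime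
open import Data.Nat.DivMod using (_%_; m%n<n; m<n⇒m%n≡m)
open import Data.Nat.Properties
open import Data.Nat.Tactic.RingSolver using (solve-∀)
open import Data.Product using (Σ; ∃; ∃₂; _×_; _,_; proj₁; proj₂; map₂)
open import Data.Rational as ℚ using (ℚ; mkℚ; 0ℚ; 1ℚ; ½; 1/_; *≤*; *<*; toℚᵘ)
import Data.Rational.Properties as ℚ
open import Data.Rational.Unnormalised as ℚᵘ using (mkℚᵘ)
import Data.Rational.Unnormalised.Properties as ℚᵘ
open import Data.Sum using (_⊎_; inj₁; inj₂; swap)
open import Data.Unit using (⊤; tt)
open import Data.Vec as Vec using (Vec; []; _∷_; lookup; tabulate; _[_]≔_)
open import Data.Vec.Properties using (lookup∘tabulate; lookup∘update; lookup∘update′; []≔-idempotent; ∷-injective; ∷-injectiveˡ; ∷-injectiveʳ; ≡-dec; tabulate-cong; tabulate∘lookup)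
open import Function using (_∘_; id; case_of_)
open import Relation.Nullary using (Dec; yes; no; does; ¬_)
open import Relation.Nullary.Decidable using (dec-true; dec-false; _→-dec_; _×-dec_; ¬?)
open import Relation.Binary.PropositionalEquality as ≡ using (_≡_; _≢_; refl; trans; cong; cong₂; subst; subst₂)
open import Algebra.Properties.CommutativeSemigroup +-commutativeSemigroup using (interchange)
open import Algebra.Properties.CommutativeSemigroup *-commutativeSemigroup using (x∙yz≈y∙xz)

-- Sums over lists and over vectors of vertices

∑ : ∀ {A : Set} → List A → (A → ℕ) → ℕ
∑ []       f = 0
∑ (x ∷ xs) f = f x + ∑ xs f

module _ {A : Set} where

  ∑-cong : ∀ (xs : List A) {f g} → (∀ x → f x ≡ g x) → ∑ xs f ≡ ∑ xs g
  ∑-cong []       e = refl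
  ∑-cong (x ∷ xs) e = cong₂ _+_ (e x) (∑-cong xs e)

  ∑-mono : ∀ (xs : List A) {f g} → (∀ x → f x ≤ g x) → ∑ xs f ≤ ∑ xs g
  ∑-mono []       e = z≤n
  ∑-mono (x ∷ xs) e = +-mono-≤ (e x) (∑-mono xs e)

  ∑-+ : ∀ (xs : List A) f g → ∑ xs (λ x → f x + g x) ≡ ∑ xs f + ∑ xs g
  ∑-+ []       f g = refl
  ∑-+ (x ∷ xs) f g rewrite ∑-+ xs f g = interchange (f x) (g x) (∑ xs f) (∑ xs g)

  ∑-*ˡ : ∀ (xs : List A) c f → ∑ xs (λ x → c * f x) ≡ c * ∑ xs f
  ∑-*ˡ []       c f = ≡.sym (*-zeroʳ c)
  ∑-*ˡ (x ∷ xs) c f rewrite ∑-*ˡ xs c f = ≡.sym (*-distribˡ-+ c (f x) (∑ xs f))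

  ∑-*ʳ : ∀ (xs : List A) c f → ∑ xs (λ x → f x * c) ≡ ∑ xs f * c
  ∑-*ʳ []       c f = refl
  ∑-*ʳ (x ∷ xs) c f rewrite ∑-*ʳ xs c f = ≡.sym (*-distribʳ-+ c (f x) (∑ xs f))

  ∑-const : ∀ (xs : List A) c → ∑ xs (λ _ → c) ≡ length xs * c
  ∑-const []       c = refl
  ∑-const (x ∷ xs) c = cong (c +_) (∑-const xs c)

  ∑-++ : ∀ (xs ys : List A) f → ∑ (xs ++ ys) f ≡ ∑ xs f + ∑ ys f
  ∑-++ []       ys f = refl
  ∑-++ (x ∷ xs) ys f = trans (cong (f x +_) (∑-++ xs ys f)) (≡.sym (+-assoc (f x) _ _))

  ∑-map : ∀ {B : Set} (g : B → A) ys f → ∑ (map g ys) f ≡ ∑ ys (f ∘ g)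
  ∑-map g []       f = refl
  ∑-map g (y ∷ ys) f = cong (f (g y) +_) (∑-map g ys f)

  -- Induction on the list: the cross term 2aS of the new entry a is bounded by applying 2ab ≤ a² +
  -- b² to every summand of S. `am-gm` is proved by induction, which avoids the subtraction in (a -
  -- b)².
  cauchy-schwarz : ∀ (xs : List A) f → ∑ xs f * ∑ xs f ≤ length xs * ∑ xs (λ x → f x * f x)
  cauchy-schwarz []       f = z≤n
  cauchy-schwarz (x ∷ xs) f = begin
    (a + S) * (a + S)               ≡⟨ square a S ⟩
    a * a + (2 * a * S + S * S)     ≤⟨ +-monoʳ-≤ (a * a) (+-mono-≤ cross (cauchy-schwarz xs f)) ⟩
    a * a + (L * (a * a) + Q + L * Q) ≡⟨ rearrange (a * a) L Q ⟩
    suc L * (a * a + Q)             ∎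
    where
    open ≤-Reasoning
    a = f x
    S = ∑ xs f
    L = length xs
    Q = ∑ xs (λ z → f z * f z)
    square : ∀ a S → (a + S) * (a + S) ≡ a * a + (2 * a * S + S * S)
    square = solve-∀
    rearrange : ∀ A L Q → A + (L * A + Q + L * Q) ≡ suc L * (A + Q)
    rearrange = solve-∀
    am-gm : ∀ a b → 2 * a * b ≤ a * a + b * b
    am-gm zero    b       = z≤n
    am-gm (suc a) zero    = ≤-trans (≤-reflexive (*-zeroʳ (2 * suc a))) z≤n
    am-gm (suc a) (suc b) = begin
      2 * suc a * suc b                     ≡⟨ lhs a b ⟩
      2 * a * b + (2 * a + 2 * b + 2)       ≤⟨ +-monoˡ-≤ _ (am-gm a b) ⟩
      a * a + b * b + (2 * a + 2 * b + 2)   ≡⟨ rhs a b ⟩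
      suc a * suc a + suc b * suc b         ∎
      where
      lhs : ∀ a b → 2 * suc a * suc b ≡ 2 * a * b + (2 * a + 2 * b + 2)
      lhs = solve-∀
      rhs : ∀ a b → a * a + b * b + (2 * a + 2 * b + 2) ≡ suc a * suc a + suc b * suc b
      rhs = solve-∀
    cross : 2 * a * S ≤ L * (a * a) + Q
    cross = begin
      2 * a * S                          ≡⟨ ∑-*ˡ xs (2 * a) f ⟨
      ∑ xs (λ z → 2 * a * f z)           ≤⟨ ∑-mono xs (λ z → am-gm a (f z)) ⟩
      ∑ xs (λ z → a * a + f z * f z)     ≡⟨ ∑-+ xs (λ _ → a * a) (λ z → f z * f z) ⟩
      ∑ xs (λ _ → a * a) + Q             ≡⟨ cong (_+ Q) (∑-const xs (a * a)) ⟩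
      L * (a * a) + Q                    ∎

∑-comm : ∀ {A B : Set} (xs : List A) (ys : List B) (f : A → B → ℕ) →
         ∑ xs (λ x → ∑ ys (f x)) ≡ ∑ ys (λ y → ∑ xs (λ x → f x y))
∑-comm []       ys f = ≡.sym (trans (∑-const ys 0) (*-zeroʳ (length ys)))
∑-comm (x ∷ xs) ys f = trans (cong (∑ ys (f x) +_) (∑-comm xs ys f)) (≡.sym (∑-+ ys (f x) _))

ind : Bool → ℕ
ind b = if b then 1 else 0

length-filterᵇ : ∀ {A : Set} (p : A → Bool) xs → length (filterᵇ p xs) ≡ ∑ xs (ind ∘ p)
length-filterᵇ p [] = refl
length-filterᵇ p (x ∷ xs) with p x
... | true = cong suc (length-filterᵇ p xs)
... | false = length-filterᵇ p xs

module _ {n : ℕ} where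

  vertices : List (Fin n)
  vertices = allFin n

  length-vertices : length vertices ≡ n
  length-vertices = length-tabulate id

  vecs : ∀ m → List (Vec (Fin n) m)
  vecs zero    = [] ∷ []
  vecs (suc m) = cartesianProductWith _∷_ vertices (vecs m)

  length-vecs : ∀ m → length (vecs m) ≡ n ^ m
  length-vecs zero    = refl
  length-vecs (suc m) = trans (go vertices) (cong₂ _*_ length-vertices (length-vecs m))
    where
    go : ∀ vs → length (cartesianProductWith Vec._∷_ vs (vecs m)) ≡ length vs * length (vecs m)
    go []       = refl
    go (v ∷ vs) = trans (length-++ (map (v ∷_) (vecs m))) (cong₂ _+_ (length-map (v ∷_) (vecs m)) (go vs))

  ∑-vecs : ∀ m F → ∑ (vecs (suc m)) F ≡ ∑ vertices (λ v → ∑ (vecs m) (λ y → F (v ∷ y)))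
  ∑-vecs m F = go vertices
    where
    go : ∀ vs → ∑ (cartesianProductWith _∷_ vs (vecs m)) F ≡ ∑ vs (λ v → ∑ (vecs m) (λ y → F (v ∷ y)))
    go []       = refl
    go (v ∷ vs) = trans (∑-++ (map (v ∷_) (vecs m)) _ F) (cong₂ _+_ (∑-map (v ∷_) (vecs m) F) (go vs))

  ∑-vertices-const : ∀ c → ∑ vertices (λ _ → c) ≡ n * c
  ∑-vertices-const c = trans (∑-const vertices c) (cong (_* c) length-vertices)

  ∑-vecs-const : ∀ m c → ∑ (vecs m) (λ _ → c) ≡ n ^ m * c
  ∑-vecs-const m c = trans (∑-const (vecs m) c) (cong (_* c) (length-vecs m))

  -- Each vector arises n times on the left, once for every value that was overwritten at `i`.
  ∑-update : ∀ {m} (i : Fin m) F → ∑ (vecs m) (λ y → ∑ vertices (λ v → F (y [ i ]≔ v))) ≡ n * ∑ (vecs m) F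
  ∑-update {suc m} zero F = begin
    ∑ (vecs (suc m)) (λ y → ∑ vertices (λ v → F (y [ zero ]≔ v)))
      ≡⟨ ∑-vecs m _ ⟩
    ∑ vertices (λ _ → ∑ (vecs m) (λ y → ∑ vertices (λ v → F (v ∷ y))))
      ≡⟨ ∑-vertices-const _ ⟩
    n * ∑ (vecs m) (λ y → ∑ vertices (λ v → F (v ∷ y)))
      ≡⟨ cong (n *_) (∑-comm (vecs m) vertices _) ⟩
    n * ∑ vertices (λ v → ∑ (vecs m) (λ y → F (v ∷ y)))
      ≡⟨ cong (n *_) (∑-vecs m F) ⟨
    n * ∑ (vecs (suc m)) F ∎
    where open ≡.≡-Reasoning
  ∑-update {suc m} (suc i) F = begin
    ∑ (vecs (suc m)) (λ y → ∑ vertices (λ v → F (y [ suc i ]≔ v)))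
      ≡⟨ ∑-vecs m _ ⟩
    ∑ vertices (λ u → ∑ (vecs m) (λ y → ∑ vertices (λ v → F (u ∷ (y [ i ]≔ v)))))
      ≡⟨ ∑-cong vertices (λ u → ∑-update i (F ∘ (u ∷_))) ⟩
    ∑ vertices (λ u → n * ∑ (vecs m) (λ y → F (u ∷ y)))
      ≡⟨ ∑-*ˡ vertices n _ ⟩
    n * ∑ vertices (λ u → ∑ (vecs m) (λ y → F (u ∷ y)))
      ≡⟨ cong (n *_) (∑-vecs m F) ⟨
    n * ∑ (vecs (suc m)) F ∎
    where open ≡.≡-Reasoning

  module _ .{{_ : NonZero n}} where

    -- `D` sums `F` over coordinate `i`, hence is invariant under updates there. After
    -- Cauchy-Schwarz for `D`, one factor of D² is expanded and `∑-update` moves its update away,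
    -- which leaves F y times the sum of `F` over all replacements of the entry at `i`.
    clone₁ : ∀ {m} (i : Fin m) F →
      n * (∑ (vecs m) F * ∑ (vecs m) F) ≤ n ^ m * ∑ vertices (λ v → ∑ (vecs m) (λ y → F y * F (y [ i ]≔ v)))
    clone₁ {m} i F = *-cancelˡ-≤ n (begin
      n * (n * (A * A))                               ≡⟨ shuffle n A ⟩
      (n * A) * (n * A)                               ≡⟨ cong₂ _*_ (∑-update i F) (∑-update i F) ⟨
      ∑ (vecs m) D * ∑ (vecs m) D                     ≤⟨ cauchy-schwarz (vecs m) D ⟩
      length (vecs m) * ∑ (vecs m) (λ y → D y * D y)  ≡⟨ cong₂ _*_ (length-vecs m) squares ⟩
      n ^ m * (n * B)                                 ≡⟨ x∙yz≈y∙xz (n ^ m) n B ⟩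
      n * (n ^ m * B)                                 ∎)
      where
      open ≤-Reasoning
      module E = ≡.≡-Reasoning
      A = ∑ (vecs m) F
      D : Vec (Fin n) m → ℕ
      D y = ∑ vertices (λ v → F (y [ i ]≔ v))
      B = ∑ vertices (λ v → ∑ (vecs m) (λ y → F y * F (y [ i ]≔ v)))
      shuffle : ∀ n A → n * (n * (A * A)) ≡ (n * A) * (n * A)
      shuffle = solve-∀
      D-update : ∀ y v → D (y [ i ]≔ v) ≡ D y
      D-update y v = ∑-cong vertices λ u → cong F ([]≔-idempotent y i)
      squares : ∑ (vecs m) (λ y → D y * D y) ≡ n * B
      squares = E.begin
        ∑ (vecs m) (λ y → D y * D y)
          E.≡⟨ ∑-cong (vecs m) (λ y → ≡.sym (∑-*ʳ vertices (D y) (λ v → F (y [ i ]≔ v)))) ⟩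
        ∑ (vecs m) (λ y → ∑ vertices (λ v → F (y [ i ]≔ v) * D y))
          E.≡⟨ ∑-cong (vecs m) (λ y → ∑-cong vertices (λ v → cong (F (y [ i ]≔ v) *_) (≡.sym (D-update y v)))) ⟩
        ∑ (vecs m) (λ y → ∑ vertices (λ v → F (y [ i ]≔ v) * D (y [ i ]≔ v)))
          E.≡⟨ ∑-update i (λ y → F y * D y) ⟩
        n * ∑ (vecs m) (λ y → F y * D y)
          E.≡⟨ cong (n *_) (∑-cong (vecs m) (λ y → ≡.sym (∑-*ˡ vertices (F y) _))) ⟩
        n * ∑ (vecs m) (λ y → ∑ vertices (λ v → F y * F (y [ i ]≔ v)))
          E.≡⟨ cong (n *_) (∑-comm (vecs m) vertices _) ⟩
        n * B E.∎

-- Cyclic indices and pigeonhole on the 5-cycle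

next₅ : Fin 5 → Fin 5
next₅ 0F = 1F
next₅ 1F = 2F
next₅ 2F = 3F
next₅ 3F = 4F
next₅ 4F = 0F

next₇ : Fin 7 → Fin 7
next₇ 0F = 1F
next₇ 1F = 2F
next₇ 2F = 3F
next₇ 3F = 4F
next₇ 4F = 5F
next₇ 5F = 6F
next₇ 6F = 0F

-- Otherwise chosen and unchosen vertices would alternate around a cycle of odd length; the case
-- tree follows the alternation until it breaks.
cover₅ : ∀ {P : Fin 5 → Set} → (∀ i → P i ⊎ P (next₅ i)) → ∃ λ i → P i × P (next₅ i)
cover₅ f with f 0F
cover₅ f | inj₁ p₀ with f 1F
... | inj₁ p₁ = 0F , p₀ , p₁
... | inj₂ p₂ with f 3F
...   | inj₁ p₃ = 2F , p₂ , p₃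
...   | inj₂ p₄ = 4F , p₄ , p₀
cover₅ f | inj₂ p₁ with f 2F
... | inj₁ p₂ = 1F , p₁ , p₂
... | inj₂ p₃ with f 4F
...   | inj₁ p₄ = 3F , p₃ , p₄
...   | inj₂ p₀ = 0F , p₀ , p₁

same-colour₅ : (c : Fin 5 → Bool) → ∃ λ j → c j ≡ c (next₅ j)
same-colour₅ c with c 0F in e₀ | c 1F in e₁ | c 2F in e₂ | c 3F in e₃ | c 4F in e₄
... | true  | true  | _     | _     | _     = 0F , trans e₀ (≡.sym e₁)
... | false | false | _     | _     | _     = 0F , trans e₀ (≡.sym e₁)
... | _     | true  | true  | _     | _     = 1F , trans e₁ (≡.sym e₂)
... | _     | false | false | _     | _     = 1F , trans e₁ (≡.sym e₂)
... | _     | _     | true  | true  | _     = 2F , trans e₂ (≡.sym e₃)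
... | _     | _     | false | false | _     = 2F , trans e₂ (≡.sym e₃)
... | _     | _     | _     | true  | true  = 3F , trans e₃ (≡.sym e₄)
... | _     | _     | _     | false | false = 3F , trans e₃ (≡.sym e₄)
... | true  | _     | _     | _     | true  = 4F , trans e₄ (≡.sym e₀)
... | false | _     | _     | _     | false = 4F , trans e₄ (≡.sym e₀)

-- Subsets of ℤ/7 as Boolean vectors

every : ∀ m → (Vec Bool m → Bool) → Bool
every zero    f = f []
every (suc m) f = every m (f ∘ (true ∷_)) ∧ every m (f ∘ (false ∷_))

every-sound : ∀ m f → every m f ≡ true → ∀ v → f v ≡ true
every-sound zero f e [] = e
every-sound (suc m) f e (b ∷ v) with every m (f ∘ (true ∷_)) in e₁
every-sound (suc m) f e (true ∷ v)  | true = every-sound m _ e₁ v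
every-sound (suc m) f e (false ∷ v) | true = every-sound m _ e v

hitting : Vec Bool 7 → Bool
hitting (a ∷ b ∷ c ∷ d ∷ e ∷ f ∷ g ∷ []) =
  (a ∨ b ∨ c) ∧ (b ∨ c ∨ d) ∧ (c ∨ d ∨ e) ∧ (d ∨ e ∨ f) ∧ (e ∨ f ∨ g) ∧ (f ∨ g ∨ a) ∧ (g ∨ a ∨ b)

meets : ∀ {m} → Vec Bool m → Vec Bool m → Bool
meets [] [] = false
meets (a ∷ u) (b ∷ v) = (a ∧ b) ∨ meets u v

meets-sound : ∀ {m} (u v : Vec Bool m) → meets u v ≡ true → ∃ λ i → lookup u i ≡ true × lookup v i ≡ true
meets-sound [] [] ()
meets-sound (true ∷ u) (true ∷ v) e = zero , refl , refl
meets-sound (true ∷ u) (false ∷ v) e with meets-sound u v e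
... | i , p = suc i , p
meets-sound (false ∷ u) (b ∷ v) e with meets-sound u v e
... | i , p = suc i , p

infixr 4 _⇒_
_⇒_ : Bool → Bool → Bool
true  ⇒ b = b
false ⇒ b = true

⇒-elim : ∀ {a b} → (a ⇒ b) ≡ true → a ≡ true → b ≡ true
⇒-elim {true} e _ = e

∨-elim : ∀ {a b} → a ∨ b ≡ true → a ≡ true ⊎ b ≡ true
∨-elim {true} _ = inj₁ refl
∨-elim {false} e = inj₂ e

-- Says that in every sequence X, Y₁, ..., Yₖ, A with all Yᵢ hitting, two consecutive terms meet.
-- Since `⇒` and `∨` stop once their first argument decides the value, evaluation descends only
-- along chains of consecutively disjoint hitting sets.
linked : ℕ → Vec Bool 7 → Vec Bool 7 → Bool
linked zero    A X = meets X A
linked (suc k) A X = every 7 λ Y → hitting Y ⇒ meets X Y ∨ linked k A Y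

linked-step : ∀ k A X Y → linked (suc k) A X ≡ true → hitting Y ≡ true →
              meets X Y ≡ true ⊎ linked k A Y ≡ true
linked-step k A X Y e t = ∨-elim (⇒-elim (every-sound 7 (λ Y → hitting Y ⇒ meets X Y ∨ linked k A Y) e Y) t)

-- A finite check by computation. With `A` at both ends and four sets in between, it covers all
-- cyclic sequences of five hitting sets.
hitting-linked : ∀ A → hitting A ≡ true → linked 4 A A ≡ true
hitting-linked A = ⇒-elim (every-sound 7 (λ A → hitting A ⇒ linked 4 A A) refl A)

hitting-meet : (X : Fin 5 → Vec Bool 7) → (∀ j → hitting (X j) ≡ true) →
               ∃ λ j → meets (X j) (X (next₅ j)) ≡ true
hitting-meet X t with linked-step 3 (X 0F) (X 0F) (X 1F) (hitting-linked (X 0F) (t 0F)) (t 1F)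
... | inj₁ m = 0F , m
... | inj₂ e₁ with linked-step 2 (X 0F) (X 1F) (X 2F) e₁ (t 2F)
...   | inj₁ m = 1F , m
...   | inj₂ e₂ with linked-step 1 (X 0F) (X 2F) (X 3F) e₂ (t 3F)
...     | inj₁ m = 2F , m
...     | inj₂ e₃ with linked-step 0 (X 0F) (X 3F) (X 4F) e₃ (t 4F)
...       | inj₁ m = 3F , m
...       | inj₂ m = 4F , m

-- Derivations

module Derivation {h} (H : Graph h) (x y : Fin h) where

  -- A `root` is the image of a vertex of `H` under the given copy; a `var` stands for a vertex of
  -- `G` chosen during the derivation.
  data Tm : Set where
    root : Fin h → Tm
    var  : ℕ → Tm

  Facts : Set
  Facts = List (ℕ × Tm)

  data Adj (E : Facts) : Tm → Tm → Set where
    edge : ∀ {u v} → adj H u v ≡ true → Adj E (root u) (root v)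
    fact : ∀ {p t} → (p , t) ∈ E → Adj E (var p) t
    fact⁻ : ∀ {p t} → (p , t) ∈ E → Adj E t (var p)

  Below : ℕ → Tm → Set
  Below p (root _) = ⊤
  Below p (var q)  = q < p

  -- Stronger than non-occurrence: variables are introduced in increasing order, so that a fresh one
  -- is found as a maximum of bounds.
  Fresh : ℕ → Facts → Set
  Fresh p = All (λ e → proj₁ e < p × Below p (proj₂ e))

  -- Der E certifies that if a positive proportion of the assignments of vertices of G to the
  -- variables satisfies E (the roots being a given copy of H), then G has many copies of H, or
  -- many copies in which xy lies on a fixed edge of the given copy.
  data Der (E : Facts) : Set where
    ext    : ∀ p t → Below p t → Fresh p E → Der ((p , t) ∷ E) → Der E
    four   : ∀ p t₀ t₁ t₂ t₃ → All (Below p) (t₀ ∷ t₁ ∷ t₂ ∷ t₃ ∷ []) → Fresh p E →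
             Der ((p , t₀) ∷ (p , t₁) ∷ E) → Der ((p , t₀) ∷ (p , t₂) ∷ E) →
             Der ((p , t₀) ∷ (p , t₃) ∷ E) → Der ((p , t₁) ∷ (p , t₂) ∷ E) →
             Der ((p , t₁) ∷ (p , t₃) ∷ E) → Der ((p , t₂) ∷ (p , t₃) ∷ E) → Der E
    global : (θ : Fin h → ℕ) →
             (∀ v w → adj H v w ≡ true → Adj E (var (θ v)) (var (θ w))) → Der E
    rooted : (σ : Fin h → Tm) (θ : Fin h → ℕ) → ∀ u v → adj H u v ≡ true →
             σ x ≡ root u → σ y ≡ root v → (∀ w → w ≢ x → w ≢ y → σ w ≡ var (θ w)) →
             (∀ v w → adj H v w ≡ true → Adj E (σ v) (σ w)) → Der E

  Adj-sym : ∀ {E s t} → Adj E s t → Adj E t s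
  Adj-sym (edge {u} {v} e) = edge (trans (Graph.sym H v u) e)
  Adj-sym (fact m) = fact⁻ m
  Adj-sym (fact⁻ m) = fact m

  Adj-mono : ∀ {E E′ s t} → E ⊆ E′ → Adj E s t → Adj E′ s t
  Adj-mono s (edge e) = edge e
  Adj-mono s (fact m) = fact (s m)
  Adj-mono s (fact⁻ m) = fact⁻ (s m)

  bound : Tm → ℕ
  bound (root _) = 0
  bound (var q)  = suc q

  Below-bound : ∀ {p} t → bound t ≤ p → Below p t
  Below-bound (root _) _ = tt
  Below-bound (var _)  l = l

  boundᶠ : Facts → ℕ
  boundᶠ [] = 0
  boundᶠ ((q , t) ∷ E) = suc q ⊔ (bound t ⊔ boundᶠ E)

  Fresh-bound : ∀ {p} E → boundᶠ E ≤ p → Fresh p E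
  Fresh-bound [] _ = []
  Fresh-bound ((q , t) ∷ E) l =
    (≤-trans (m≤m⊔n (suc q) (bound t ⊔ boundᶠ E)) l , Below-bound t (≤-trans (m≤m⊔n (bound t) _) l′))
    ∷ Fresh-bound E (≤-trans (m≤n⊔m (bound t) _) l′)
    where l′ = ≤-trans (m≤n⊔m (suc q) (bound t ⊔ boundᶠ E)) l

  -- Forces Q E: for the purpose of deriving, Q may be assumed to hold after enlarging E.
  Forces : (Facts → Set) → Facts → Set
  Forces Q E = ∀ {E′} → E ⊆ E′ → (∀ {E″} → E′ ⊆ E″ → Q E″ → Der E″) → Der E′

  infixl 1 _▷_
  _▷_ : ∀ {Q E} → Forces Q E → (∀ {E′} → E ⊆ E′ → Q E′ → Der E′) → Der E
  m ▷ k = m id k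

  Monotone : (Facts → Set) → Set
  Monotone Q = ∀ {E E′} → E ⊆ E′ → Q E → Q E′

  -- The continuations are nested, and a conclusion reached early is carried by `mono` into the
  -- larger lists of facts that the later ones produce.
  forces-all : ∀ {m E} {Q : Fin m → Facts → Set} → (∀ i → Monotone (Q i)) →
               (∀ i → Forces (Q i) E) → Forces (λ E′ → ∀ i → Q i E′) E
  forces-all {zero}  mono f s k = k id λ ()
  forces-all {suc m} mono f s k =
    f zero s λ s₁ q → forces-all (mono ∘ suc) (f ∘ suc) (s₁ ∘ s) λ s₂ qs →
      k (s₂ ∘ s₁) λ { zero → mono zero s₂ q ; (suc i) → qs i }

  neighbour : ∀ {E} t → Forces (λ E′ → ∃ λ p → Adj E′ (var p) t) E
  neighbour t {E′} s k =
    ext p t (Below-bound t (m≤m⊔n (bound t) _)) (Fresh-bound E′ (m≤n⊔m (bound t) _))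
      (k there (p , fact (here refl)))
    where p = bound t ⊔ boundᶠ E′

  data Two (E : Facts) (t₀ t₁ t₂ t₃ : Tm) (p : ℕ) : Set where
    t₀₁ : Adj E (var p) t₀ → Adj E (var p) t₁ → Two E t₀ t₁ t₂ t₃ p
    t₀₂ : Adj E (var p) t₀ → Adj E (var p) t₂ → Two E t₀ t₁ t₂ t₃ p
    t₀₃ : Adj E (var p) t₀ → Adj E (var p) t₃ → Two E t₀ t₁ t₂ t₃ p
    t₁₂ : Adj E (var p) t₁ → Adj E (var p) t₂ → Two E t₀ t₁ t₂ t₃ p
    t₁₃ : Adj E (var p) t₁ → Adj E (var p) t₃ → Two E t₀ t₁ t₂ t₃ p
    t₂₃ : Adj E (var p) t₂ → Adj E (var p) t₃ → Two E t₀ t₁ t₂ t₃ p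

  two-of-four : ∀ {E} t₀ t₁ t₂ t₃ → Forces (λ E′ → ∃ (Two E′ t₀ t₁ t₂ t₃)) E
  two-of-four t₀ t₁ t₂ t₃ {E′} s k =
    four p t₀ t₁ t₂ t₃
      (Below-bound t₀ (m≤m⊔n b₀ _) ∷ Below-bound t₁ (≤-trans (m≤m⊔n b₁ _) l₁)
        ∷ Below-bound t₂ (≤-trans (m≤m⊔n b₂ _) l₂) ∷ Below-bound t₃ (≤-trans (m≤m⊔n b₃ _) l₃) ∷ [])
      (Fresh-bound E′ (≤-trans (m≤n⊔m b₃ _) l₃))
      (k (there ∘ there) (p , t₀₁ 1st 2nd)) (k (there ∘ there) (p , t₀₂ 1st 2nd))
      (k (there ∘ there) (p , t₀₃ 1st 2nd)) (k (there ∘ there) (p , t₁₂ 1st 2nd))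
      (k (there ∘ there) (p , t₁₃ 1st 2nd)) (k (there ∘ there) (p , t₂₃ 1st 2nd))
    where
    b₀ = bound t₀
    b₁ = bound t₁
    b₂ = bound t₂
    b₃ = bound t₃
    p = b₀ ⊔ (b₁ ⊔ (b₂ ⊔ (b₃ ⊔ boundᶠ E′)))
    l₁ = m≤n⊔m b₀ (b₁ ⊔ (b₂ ⊔ (b₃ ⊔ boundᶠ E′)))
    l₂ = ≤-trans (m≤n⊔m b₁ (b₂ ⊔ (b₃ ⊔ boundᶠ E′))) l₁
    l₃ = ≤-trans (m≤n⊔m b₂ (b₃ ⊔ boundᶠ E′)) l₂
    1st : ∀ {t e} → Adj ((p , t) ∷ e ∷ E′) (var p) t
    1st = fact (here refl)
    2nd : ∀ {t e} → Adj (e ∷ (p , t) ∷ E′) (var p) t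
    2nd = fact (there (here refl))

  -- Walks through variables

  infixr 5 _∷_ _++ʷ_
  data Walk (E : Facts) : ℕ → ℕ → ℕ → Set where
    []  : ∀ {p} → Walk E 0 p p
    _∷_ : ∀ {p q r l} → Adj E (var p) (var q) → Walk E l q r → Walk E (suc l) p r

  Walk-mono : ∀ {E E′ l p q} → E ⊆ E′ → Walk E l p q → Walk E′ l p q
  Walk-mono s [] = []
  Walk-mono s (e ∷ w) = Adj-mono s e ∷ Walk-mono s w

  _++ʷ_ : ∀ {E l m p q r} → Walk E l p q → Walk E m q r → Walk E (l + m) p r
  []      ++ʷ w′ = w′
  (e ∷ w) ++ʷ w′ = e ∷ (w ++ʷ w′)

  infixl 6 _∷ʳʷ_
  _∷ʳʷ_ : ∀ {E l p q r} → Walk E l p q → Adj E (var q) (var r) → Walk E (suc l) p r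
  []      ∷ʳʷ e′ = e′ ∷ []
  (e ∷ w) ∷ʳʷ e′ = e ∷ (w ∷ʳʷ e′)

  reverseʷ : ∀ {E l p q} → Walk E l p q → Walk E l q p
  reverseʷ [] = []
  reverseʷ (e ∷ w) = reverseʷ w ∷ʳʷ Adj-sym e

  backtrack : ∀ {E l p q} → Walk E (suc l) p q → Walk E (3 + l) p q
  backtrack (e ∷ w) = e ∷ Adj-sym e ∷ e ∷ w

  data Place (l : ℕ) : Set where
    apexˣ apexʸ : Place l
    inner : Fin (suc l) → Place l

  data Step {l} : Place l → Place l → Set where
    xy    : Step apexˣ apexʸ
    first : Step apexˣ (inner zero)
    next  : ∀ i → Step (inner (inject₁ i)) (inner (suc i))
    last  : Step (inner (Fin.fromℕ l)) apexʸ

  Near : ∀ {l} → Place l → Place l → Set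
  Near a b = Step a b ⊎ Step b a

  -- A homomorphism from H to the cycle of length l + 3 under which x and y alone are
  -- mapped to the two ends of a distinguished edge.
  record CycleMap (l : ℕ) : Set where
    field
      place   : Fin h → Place l
      place-x : place x ≡ apexˣ
      place-y : place y ≡ apexʸ
      onlyˣ   : ∀ w → place w ≡ apexˣ → w ≡ x
      onlyʸ   : ∀ w → place w ≡ apexʸ → w ≡ y
      near    : ∀ v w → adj H v w ≡ true → Near (place v) (place w)

  visit : ∀ {E l p q} → Walk E l p q → Fin (suc l) → ℕ
  visit {p = p} w zero = p
  visit (e ∷ w) (suc i) = visit w i

  visit-last : ∀ {E l p q} (w : Walk E l p q) → visit w (Fin.fromℕ l) ≡ q
  visit-last [] = refl
  visit-last (e ∷ w) = visit-last w

  visit-next : ∀ {E l p q} (w : Walk E l p q) (i : Fin l) →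
               Adj E (var (visit w (inject₁ i))) (var (visit w (suc i)))
  visit-next (e ∷ w) zero = e
  visit-next (e ∷ w) (suc i) = visit-next w i

  termAt : ∀ {E l p q} → Walk E l p q → Tm → Tm → Place l → Tm
  termAt w s t apexˣ = s
  termAt w s t apexʸ = t
  termAt w s t (inner i) = var (visit w i)

  termAt-near : ∀ {E l p q} (w : Walk E l p q) {s t} → Adj E s (var p) → Adj E (var q) t → Adj E s t →
                ∀ {a b} → Near a b → Adj E (termAt w s t a) (termAt w s t b)
  termAt-near w {s} {t} sp qt st = λ { (inj₁ n) → go n ; (inj₂ n) → Adj-sym (go n) }
    where
    go : ∀ {a b} → Step a b → Adj _ (termAt w s t a) (termAt w s t b)
    go xy = st
    go first = sp
    go (next i) = visit-next w i
    go last = subst (λ r → Adj _ (var r) t) (≡.sym (visit-last w)) qt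

  module _ {l} (C : CycleMap l) where
    open CycleMap C

    -- The walk and the vertices a, b form a closed walk of length l + 3; composing it with the
    -- cycle map sends `H` to variables.
    closed-leaf : ∀ {E a b p q} → Adj E (var a) (var p) → Walk E l p q → Adj E (var q) (var b) →
                  Adj E (var a) (var b) → Der E
    closed-leaf {a = a} {b} ap w qb ab = global (varAt ∘ place) λ u v e →
      subst₂ (Adj _) (term≡ (place u)) (term≡ (place v)) (termAt-near w ap qb ab (near u v e))
      where
      varAt : Place l → ℕ
      varAt apexˣ = a
      varAt apexʸ = b
      varAt (inner i) = visit w i
      term≡ : ∀ c → termAt w (var a) (var b) c ≡ var (varAt c)
      term≡ apexˣ = refl
      term≡ apexʸ = refl
      term≡ (inner i) = refl

    -- Here the edge u v of the given copy closes the walk. Only x and y lie at the apexes, so they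
    -- alone are sent to roots.
    rooted-leaf : ∀ {E u v p q} → adj H u v ≡ true → Adj E (var p) (root u) → Walk E l p q →
                  Adj E (var q) (root v) → Der E
    rooted-leaf {u = u} {v} {p} uv pu w qv =
      rooted (termAt w (root u) (root v) ∘ place) (varAt ∘ place) u v uv
        (cong (termAt w _ _) place-x) (cong (termAt w _ _) place-y)
        (λ z z≢x z≢y → term≡ (place z) (z≢x ∘ onlyˣ z) (z≢y ∘ onlyʸ z))
        (λ a b e → termAt-near w (Adj-sym pu) qv (edge uv) (near a b e))
      where
      varAt : Place l → ℕ
      varAt (inner i) = visit w i
      -- An arbitrary value at the apexes: `rooted` constrains `θ` only at vertices other than x and
      -- y, and these have inner places.
      varAt _ = p
      term≡ : ∀ c → c ≢ apexˣ → c ≢ apexʸ → termAt w (root u) (root v) c ≡ var (varAt c)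
      term≡ apexˣ n _ = ⊥-elim (n refl)
      term≡ apexʸ _ n = ⊥-elim (n refl)
      term≡ (inner i) _ _ = refl

  -- Parities of walks

  odd : ℕ → Bool
  odd zero = false
  odd (suc n) = not (odd n)

  odd-+ : ∀ m n → odd (m + n) ≡ odd m xor odd n
  odd-+ zero n = refl
  odd-+ (suc m) n = trans (cong not (odd-+ m n)) (not-xor (odd m) (odd n))
    where
    not-xor : ∀ a b → not (a xor b) ≡ not a xor b
    not-xor true true = refl
    not-xor true false = refl
    not-xor false b = refl

  odd-half : ∀ n → odd n ≡ true → ∃ λ k → n ≡ suc (k * 2)
  odd-half (suc zero) _ = 0 , refl
  odd-half (suc (suc n)) o with odd-half n (trans (≡.sym (not-involutive (odd n))) o)
  ... | k , eq = suc k , cong (2 +_) eq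

  -- Abstracts from the reason why a closed walk of length 7 suffices: a 7-cycle map gives it at
  -- once, whereas a 5-cycle map needs the hitting sets.
  module OddWalks (leaf₇ : ∀ {E p} → Walk E 7 p p → Der E) where

    closed₃ : ∀ {E p} → Walk E 3 p p → Der E
    closed₃ w = leaf₇ (backtrack (backtrack w))

    -- In a closed walk of odd length at least 9, any two of the vertices with indices
    -- 0, 1, 4, 5 that have a common neighbour give a shorter closed walk of odd length.
    shorten : ∀ {E p l} → Walk E (9 + l) p p → (∀ {E′ q} → Walk E′ (7 + l) q q → Der E′) → Der E
    shorten {p = p} (_∷_ {q = v₁} e₀ (e₁ ∷ e₂ ∷ _∷_ {q = v₄} e₃ (_∷_ {q = v₅} e₄ w))) k =
      two-of-four (var p) (var v₁) (var v₄) (var v₅) ▷ λ where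
        s (_ , t₀₁ a b) → closed₃ (b ∷ Adj-sym (Adj-mono s e₀) ∷ Adj-sym a ∷ [])
        s (_ , t₀₂ a b) → k (b ∷ Adj-mono s e₄ ∷ (Walk-mono s w ∷ʳʷ Adj-sym a))
        s (_ , t₀₃ a b) → leaf₇ (a ∷ (Walk-mono s (e₀ ∷ e₁ ∷ e₂ ∷ e₃ ∷ e₄ ∷ []) ∷ʳʷ Adj-sym b))
        s (_ , t₁₂ a b) → leaf₇ (backtrack (a ∷ (Walk-mono s (e₁ ∷ e₂ ∷ e₃ ∷ []) ∷ʳʷ Adj-sym b)))
        s (_ , t₁₃ a b) → k (b ∷ (Walk-mono s w ∷ʳʷ Adj-mono s e₀ ∷ʳʷ Adj-sym a))
        s (_ , t₂₃ a b) → closed₃ (a ∷ Adj-mono s e₄ ∷ Adj-sym b ∷ [])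

    odd-closed′ : ∀ {E p} k → Walk E (suc (k * 2)) p p → Der E
    odd-closed′ 0 w = closed₃ (backtrack w)
    odd-closed′ 1 w = closed₃ w
    odd-closed′ 2 w = leaf₇ (backtrack w)
    odd-closed′ 3 w = leaf₇ w
    odd-closed′ (suc k@(suc (suc (suc _)))) w = shorten w λ w′ → odd-closed′ k w′

    odd-closed : ∀ {E l p} → odd l ≡ true → Walk E l p p → Der E
    odd-closed {l = l} o w with odd-half l o
    ... | k , refl = odd-closed′ k w

    data Link (E : Facts) (p q : ℕ) : Set where
      link₂ : Walk E 2 p q → Link E p q
      link₃ : Walk E 3 p q → Link E p q
      link₄ : Walk E 4 p q → Link E p q

    -- Take neighbours p′ of p and q′ of q. Of p, p′, q, q′ two share a neighbour: within {p, p′} or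
    -- {q, q′} this gives a triangle, and across it gives a walk of length 2, 3 or 4.
    link : ∀ {E} p q → Forces (λ E′ → Link E′ p q) E
    link p q s k =
      neighbour (var p) s λ s₁ (p′ , pe) → neighbour (var q) id λ s₂ (q′ , qe) →
      two-of-four (var p) (var p′) (var q) (var q′) id λ s₃ →
      let k′ = k (s₃ ∘ s₂ ∘ s₁)
          pe′ = Adj-mono (s₃ ∘ s₂) pe
          qe′ = Adj-mono s₃ qe
      in λ { (_ , t₀₁ a b) → closed₃ (b ∷ pe′ ∷ Adj-sym a ∷ [])
           ; (_ , t₀₂ a b) → k′ (link₂ (Adj-sym a ∷ b ∷ []))
           ; (_ , t₀₃ a b) → k′ (link₃ (Adj-sym a ∷ b ∷ qe′ ∷ []))
           ; (_ , t₁₂ a b) → k′ (link₃ (Adj-sym pe′ ∷ Adj-sym a ∷ b ∷ []))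
           ; (_ , t₁₃ a b) → k′ (link₄ (Adj-sym pe′ ∷ Adj-sym a ∷ b ∷ qe′ ∷ []))
           ; (_ , t₂₃ a b) → closed₃ (b ∷ qe′ ∷ Adj-sym a ∷ []) }

    Parity : Bool → ℕ → ℕ → Facts → Set
    Parity c p q E = ∃ λ l → Walk E l p q × odd l ≡ c

    Parity-mono : ∀ {c p q} → Monotone (Parity c p q)
    Parity-mono s (l , w , o) = l , Walk-mono s w , o

    Link⇒Parity : ∀ {E p q} → Link E p q → ∃ λ c → Parity c p q E
    Link⇒Parity (link₂ w) = false , 2 , w , refl
    Link⇒Parity (link₃ w) = true , 3 , w , refl
    Link⇒Parity (link₄ w) = false , 4 , w , refl

    Parity-trans : ∀ {E b c p q r} → Parity b p q E → Parity c q r E → Parity (b xor c) p r E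
    Parity-trans (l , w , o) (l′ , w′ , o′) = l + l′ , w ++ʷ w′ , trans (odd-+ l l′) (cong₂ _xor_ o o′)

    Parity-sym : ∀ {E c p q} → Parity c p q E → Parity c q p E
    Parity-sym (l , w , o) = l , reverseʷ w , o

    Parity-closed : ∀ {E p} → Parity true p p E → Der E
    Parity-closed (l , w , o) = odd-closed o w

-- Derivations from a 7-cycle map and from a 5-cycle map

does⇒ : ∀ {a} {A : Set a} (d : Dec A) → does d ≡ true → A
does⇒ (yes p) _ = p

-- Selecting one of l, l+1, l+2 for every l yields a set that hits all intervals of length 3.
hitting-selection : (P : Fin 7 → Set) → (∀ l → P l ⊎ P (next₇ l) ⊎ P (next₇ (next₇ l))) →
                    ∃ λ X → hitting X ≡ true × (∀ l → lookup X l ≡ true → P l)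
hitting-selection P f = X , hits , sound
  where
  pick : ∀ l → ∃ P
  pick l with f l
  ... | inj₁ p = _ , p
  ... | inj₂ (inj₁ p) = _ , p
  ... | inj₂ (inj₂ p) = _ , p
  b : Fin 7 → Bool
  b l = does (any? λ l′ → proj₁ (pick l′) Fin.≟ l)
  b-pick : ∀ l → b (proj₁ (pick l)) ≡ true
  b-pick l = dec-true (any? λ l′ → proj₁ (pick l′) Fin.≟ proj₁ (pick l)) (l , refl)
  X : Vec Bool 7
  X = tabulate b
  interval : ∀ l → b l ∨ b (next₇ l) ∨ b (next₇ (next₇ l)) ≡ true
  interval l with f l | b-pick l
  ... | inj₁ _ | e rewrite e = refl
  ... | inj₂ (inj₁ _) | e rewrite e = ∨-zeroʳ (b l)
  ... | inj₂ (inj₂ _) | e rewrite e | ∨-zeroʳ (b (next₇ l)) = ∨-zeroʳ (b l)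
  hits : hitting X ≡ true
  hits rewrite interval 0F | interval 1F | interval 2F | interval 3F | interval 4F | interval 5F | interval 6F = refl
  sound : ∀ l → lookup X l ≡ true → P l
  sound l e =
    let l′ , eq = does⇒ (any? λ l′ → proj₁ (pick l′) Fin.≟ l) (trans (≡.sym (lookup∘tabulate b l)) e)
    in subst P eq (proj₂ (pick l′))

module _ {h} (H : Graph h) (x y : Fin h) where
  open Derivation H x y

  Adjacent : Fin h → Facts → Set
  Adjacent a E = ∃ λ p → Adj E (var p) (root a)

  module _ (C : CycleMap 4)
           (monochromatic : (c : Fin h → Bool) → ∃₂ λ u v → adj H u v ≡ true × c u ≡ c v) where

    closed₇ : ∀ {E p} → Walk E 7 p p → Der E
    closed₇ (e₀ ∷ e₁ ∷ e₂ ∷ e₃ ∷ e₄ ∷ e₅ ∷ e₆ ∷ []) =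
      closed-leaf C e₀ (e₁ ∷ e₂ ∷ e₃ ∷ e₄ ∷ []) e₅ (Adj-sym e₆)

    open OddWalks closed₇

    -- A vertex of `H` is coloured by the parity of a walk from the chosen neighbour of x to its
    -- own. On a monochromatic edge u v, a link of length 3 completes an odd closed walk, and a link
    -- of length 2 or 4 gives a walk of length 4, so that xy can be placed on u v.
    derivation₇ : Der []
    derivation₇ =
      forces-all {Q = Adjacent} (λ _ s → map₂ (Adj-mono s)) (λ a → neighbour (root a)) ▷ λ _ nb →
      forces-all {Q = λ a E → ∃ λ c → Parity c (proj₁ (nb x)) (proj₁ (nb a)) E}
        (λ _ s → map₂ (Parity-mono s))
        (λ a s k → link (proj₁ (nb x)) (proj₁ (nb a)) s λ s′ → k s′ ∘ Link⇒Parity) ▷ λ s₁ par →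
      let u , v , uv , c≡ = monochromatic (proj₁ ∘ par)
          leaf : ∀ {E} → _ ⊆ E → Walk E 4 (proj₁ (nb u)) (proj₁ (nb v)) → Der E
          leaf s w = rooted-leaf C uv (Adj-mono (s ∘ s₁) (proj₂ (nb u))) w (Adj-mono (s ∘ s₁) (proj₂ (nb v)))
      in link (proj₁ (nb u)) (proj₁ (nb v)) ▷ λ where
        s (link₂ w) → leaf s (backtrack w)
        s (link₄ w) → leaf s w
        s (link₃ w) → Parity-closed (subst (λ c → Parity c _ _ _) (odd-triangle c≡)
          (Parity-trans (Parity-mono s (proj₂ (par u)))
            (Parity-trans (3 , w , refl) (Parity-sym (Parity-mono s (proj₂ (par v)))))))
      where
      odd-triangle : ∀ {c d} → c ≡ d → c xor (true xor d) ≡ true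
      odd-triangle {true} refl = refl
      odd-triangle {false} refl = refl

  module _ (C : CycleMap 2) (a : Fin 5 → Fin h) (a-edge : ∀ j → adj H (a j) (a (next₅ j)) ≡ true) where

    leaf₅ : ∀ {E p} → Walk E 5 p p → Der E
    leaf₅ (e₀ ∷ e₁ ∷ e₂ ∷ e₃ ∷ e₄ ∷ []) = closed-leaf C e₀ (e₁ ∷ e₂ ∷ []) e₃ (Adj-sym e₄)

    rooted₂ : ∀ {E p q} j → Adj E (var p) (root (a j)) → Walk E 2 p q →
              Adj E (var q) (root (a (next₅ j))) → Der E
    rooted₂ j = rooted-leaf C (a-edge j)

    -- The vertices of a closed walk of length 7 are numbered so that l and l + 2 are adjacent.
    -- Among l, l + 1, l + 2 and a root, two have a common neighbour.
    module _ {E₀ : Facts} (w : Fin 7 → ℕ) (w-edge : ∀ l → Adj E₀ (var (w l)) (var (w (next₇ (next₇ l))))) where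

      Common : Fin 5 → Fin 7 → Facts → Set
      Common j l E = ∃ λ p → Adj E (var p) (root (a j)) × Adj E (var p) (var (w l))

      Common-mono : ∀ j l → Monotone (Common j l)
      Common-mono j l s (p , e , e′) = p , Adj-mono s e , Adj-mono s e′

      Interval : Fin 5 → Fin 7 → Facts → Set
      Interval j l E = Common j l E ⊎ Common j (next₇ l) E ⊎ Common j (next₇ (next₇ l)) E

      Interval-mono : ∀ j l → Monotone (Interval j l)
      Interval-mono j l s (inj₁ c) = inj₁ (Common-mono j l s c)
      Interval-mono j l s (inj₂ (inj₁ c)) = inj₂ (inj₁ (Common-mono j _ s c))
      Interval-mono j l s (inj₂ (inj₂ c)) = inj₂ (inj₂ (Common-mono j _ s c))

      -- Three steps of 2 lead from l + 1 to l + 7, which is l modulo 7.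
      back : ∀ l → Walk E₀ 3 (w (next₇ l)) (w l)
      back l = subst (Walk E₀ 3 (w (next₇ l)) ∘ w) (round l) (w-edge _ ∷ w-edge _ ∷ w-edge _ ∷ [])
        where
        round : ∀ l → next₇ (next₇ (next₇ (next₇ (next₇ (next₇ (next₇ l)))))) ≡ l
        round 0F = refl
        round 1F = refl
        round 2F = refl
        round 3F = refl
        round 4F = refl
        round 5F = refl
        round 6F = refl

      -- A common neighbour of two cyclically consecutive indices closes `back` to length 5, and one
      -- of l and l + 2 completes a triangle. The three remaining pairs contain the root.
      interval : ∀ {E} → E₀ ⊆ E → ∀ j l → Forces (Interval j l) E
      interval s₀ j l s k =
        two-of-four (var (w l)) (var (w (next₇ l))) (var (w (next₇ (next₇ l)))) (root (a j)) s λ where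
          s₁ (p , t₀₁ e e′) → leaf₅ (e′ ∷ Walk-mono (s₁ ∘ s ∘ s₀) (back l) ∷ʳʷ Adj-sym e)
          s₁ (p , t₀₂ e e′) → leaf₅ (backtrack (e ∷ Adj-mono (s₁ ∘ s ∘ s₀) (w-edge l) ∷ Adj-sym e′ ∷ []))
          s₁ (p , t₀₃ e e′) → k s₁ (inj₁ (p , e′ , e))
          s₁ (p , t₁₂ e e′) → leaf₅ (e′ ∷ Walk-mono (s₁ ∘ s ∘ s₀) (back (next₇ l)) ∷ʳʷ Adj-sym e)
          s₁ (p , t₁₃ e e′) → k s₁ (inj₂ (inj₁ (p , e′ , e)))
          s₁ (p , t₂₃ e e′) → k s₁ (inj₂ (inj₂ (p , e′ , e)))

      -- The indices that share a neighbour with a given root form a hitting set. By `hitting-meet`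
      -- two consecutive roots have a common index l, and w l is the middle of a walk of length 2
      -- between their neighbours.
      derivation-from-7-cycle : Der E₀
      derivation-from-7-cycle =
        forces-all {Q = λ j E → ∀ l → Interval j l E} (λ j s i l → Interval-mono j l s (i l))
          (λ j → forces-all (Interval-mono j) (interval id j)) ▷ λ s ints →
        let sel = λ j → hitting-selection (λ l → Common j l _) (ints j)
            j , m = hitting-meet (proj₁ ∘ sel) (proj₁ ∘ proj₂ ∘ sel)
            l , e , e′ = meets-sound (proj₁ (sel j)) (proj₁ (sel (next₅ j))) m
            p , pa , pw = proj₂ (proj₂ (sel j)) l e
            q , qa , qw = proj₂ (proj₂ (sel (next₅ j))) l e′
        in rooted₂ j pa (pw ∷ Adj-sym qw ∷ []) qa

    leaf₇ : ∀ {E p} → Walk E 7 p p → Der E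
    leaf₇ (_∷_ {p = v₀} e₀ (_∷_ {p = v₁} e₁ (_∷_ {p = v₂} e₂ (_∷_ {p = v₃} e₃ (_∷_ {p = v₄} e₄
            (_∷_ {p = v₅} e₅ (_∷_ {p = v₆} e₆ []))))))) =
      -- The vertex v_k is put at position 2k modulo 7, so that positions l and l + 2 hold
      -- consecutive vertices of the walk.
      derivation-from-7-cycle (lookup (v₀ ∷ v₄ ∷ v₁ ∷ v₅ ∷ v₂ ∷ v₆ ∷ v₃ ∷ []))
        λ { 0F → e₀ ; 1F → e₄ ; 2F → e₁ ; 3F → e₅ ; 4F → e₂ ; 5F → e₆ ; 6F → e₃ }

    open OddWalks leaf₇

    module _ {E₀ : Facts} (nb : ∀ i → Adjacent (a i) E₀) (o : ℕ) where

      Opposite : Fin 5 → Facts → Set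
      Opposite i E = ∃ λ p → Adj E (var p) (root (a i)) × Parity true o p E

      Opposite-mono : ∀ i → Monotone (Opposite i)
      Opposite-mono i s (p , e , w) = p , Adj-mono s e , Parity-mono s w

      -- If both chosen neighbours are at even distance parity from `o`, two of the four vertices a
      -- i, nb i and their successors share a neighbour p. Either p is adjacent to one of the roots
      -- and one of the chosen neighbours, hence opposite to `o`, or xy can be placed on the edge
      -- from a i to its successor.
      one-opposite : (∀ i → ∃ λ c → Parity c o (proj₁ (nb i)) E₀) →
                     ∀ i → Forces (λ E → Opposite i E ⊎ Opposite (next₅ i) E) E₀
      one-opposite par i s k with par i | par (next₅ i)
      ... | true , w | _ = k id (inj₁ (_ , Adj-mono s (proj₂ (nb i)) , Parity-mono s w))
      ... | false , _ | true , w = k id (inj₂ (_ , Adj-mono s (proj₂ (nb (next₅ i))) , Parity-mono s w))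
      ... | false , w | false , w′ =
        two-of-four (root (a i)) (var (proj₁ (nb i))) (root (a (next₅ i))) (var (proj₁ (nb (next₅ i)))) s λ where
          s₁ (p , t₀₁ e e′) → k s₁ (inj₁ (p , e , via (s₁ ∘ s) w e′))
          -- A triangle on the edge: p serves as both ends of a walk of length 2 through any of its
          -- neighbours.
          s₁ (p , t₀₂ e e′) → neighbour (var p) ▷ λ s₂ (q , qp) →
            rooted₂ i (Adj-mono s₂ e) (Adj-sym qp ∷ qp ∷ []) (Adj-mono s₂ e′)
          s₁ (p , t₀₃ e e′) → k s₁ (inj₁ (p , e , via (s₁ ∘ s) w′ e′))
          s₁ (p , t₁₂ e e′) → k s₁ (inj₂ (p , e′ , via (s₁ ∘ s) w e))
          s₁ (p , t₁₃ e e′) → rooted₂ i (Adj-mono (s₁ ∘ s) (proj₂ (nb i))) (Adj-sym e ∷ e′ ∷ [])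
                                (Adj-mono (s₁ ∘ s) (proj₂ (nb (next₅ i))))
          s₁ (p , t₂₃ e e′) → k s₁ (inj₂ (p , e , via (s₁ ∘ s) w′ e′))
        where
        via : ∀ {E p q} → E₀ ⊆ E → Parity false o q E₀ → Adj E (var p) (var q) → Parity true o p E
        via s w e = Parity-trans (Parity-mono s w) (1 , Adj-sym e ∷ [] , refl)

    -- Two consecutive chosen neighbours `o`, `o′` have equal parity. By `one-opposite` and
    -- `cover₅`, two consecutive roots also have neighbours `p`, `q` opposite to `o`. A common
    -- neighbour inside {o, o′} or {p, q} places xy on the corresponding edge, and one across the
    -- two pairs gives an odd closed walk.
    derivation₅ : Der []
    derivation₅ =
      forces-all {Q = Adjacent ∘ a} (λ _ s → map₂ (Adj-mono s)) (λ i → neighbour (root (a i))) ▷ λ {E₁} _ nb →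
      forces-all {Q = λ i E → ∃ λ c → Parity c (proj₁ (nb 0F)) (proj₁ (nb i)) E}
        (λ _ s → map₂ (Parity-mono s))
        (λ i s k → link (proj₁ (nb 0F)) (proj₁ (nb i)) s λ s′ → k s′ ∘ Link⇒Parity) ▷ λ s₁ par →
      let j , c≡ = same-colour₅ (proj₁ ∘ par)
          nb₁ = λ i → map₂ (Adj-mono s₁) (nb i)
          o = proj₁ (nb j)
          o′ = proj₁ (nb (next₅ j))
          fromO : ∀ i → ∃ λ c → Parity c o (proj₁ (nb i)) _
          fromO i = _ , Parity-trans (Parity-sym (proj₂ (par j))) (proj₂ (par i))
          o′o : Parity false o′ o _
          o′o = subst (λ c → Parity c o′ o _) (trans (cong (_xor proj₁ (par j)) (≡.sym c≡)) (xor-same (proj₁ (par j))))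
            (Parity-trans (Parity-sym (proj₂ (par (next₅ j)))) (proj₂ (par j)))
      in
      forces-all {Q = λ i E → Opposite nb₁ o i E ⊎ Opposite nb₁ o (next₅ i) E}
        (λ i s → λ { (inj₁ q) → inj₁ (Opposite-mono nb₁ o i s q)
                   ; (inj₂ q) → inj₂ (Opposite-mono nb₁ o (next₅ i) s q) })
        (one-opposite nb₁ o fromO) ▷ λ s₂ opp →
      let i , (p , pa , po) , (q , qa , qo) = cover₅ opp in
      two-of-four (var o) (var o′) (var p) (var q) ▷ λ where
        s (_ , t₀₁ e e′) → rooted₂ j (Adj-mono (s ∘ s₂) (proj₂ (nb₁ j))) (Adj-sym e ∷ e′ ∷ [])
                             (Adj-mono (s ∘ s₂) (proj₂ (nb₁ (next₅ j))))
        s (_ , t₀₂ e e′) → Parity-closed (Parity-trans (Parity-mono s po) (2 , Adj-sym e′ ∷ e ∷ [] , refl))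
        s (_ , t₀₃ e e′) → Parity-closed (Parity-trans (Parity-mono s qo) (2 , Adj-sym e′ ∷ e ∷ [] , refl))
        s (_ , t₁₂ e e′) → Parity-closed (Parity-trans (Parity-mono (s ∘ s₂) o′o)
                             (Parity-trans (Parity-mono s po) (2 , Adj-sym e′ ∷ e ∷ [] , refl)))
        s (_ , t₁₃ e e′) → Parity-closed (Parity-trans (Parity-mono (s ∘ s₂) o′o)
                             (Parity-trans (Parity-mono s qo) (2 , Adj-sym e′ ∷ e ∷ [] , refl)))
        s (_ , t₂₃ e e′) → rooted₂ i (Adj-mono s pa) (Adj-sym e ∷ e′ ∷ []) (Adj-mono s qa)

-- Mapping H to a cycle

≢⇒≡ : ∀ {a b c : Bool} → a ≢ b → c ≢ b → a ≡ c
≢⇒≡ p q = trans (¬-not p) (≡.sym (¬-not q))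

module _ {h} (H : Graph h) where

  loopless : ∀ {u v} → adj H u v ≡ true → u ≢ v
  loopless {u} e refl with trans (≡.sym e) (irrefl H u)
  ... | ()

  adj-sym : ∀ {u v} → adj H u v ≡ true → adj H v u ≡ true
  adj-sym {u} {v} e = trans (Graph.sym H v u) e

  triangle-free : OddGirth≥ H 5 → ∀ {u v w} → adj H u v ≡ true → adj H v w ≡ true → adj H w u ≡ true → ⊥
  triangle-free og {u} {v} {w} uv vw wu 
    with og 1 (lookup (u ∷ v ∷ w ∷ []))
           (s≤s (s≤s (s≤s z≤n)) , inj , λ { 0F → uv ; 1F → vw ; 2F → wu })
    where
    inj : ∀ {i j} → lookup (u ∷ v ∷ w ∷ []) i ≡ lookup (u ∷ v ∷ w ∷ []) j → i ≡ j
    inj {0F} {0F} _ = refl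
    inj {0F} {1F} e = ⊥-elim (loopless uv e)
    inj {0F} {2F} e = ⊥-elim (loopless wu (≡.sym e))
    inj {1F} {0F} e = ⊥-elim (loopless uv (≡.sym e))
    inj {1F} {1F} _ = refl
    inj {1F} {2F} e = ⊥-elim (loopless vw e)
    inj {2F} {0F} e = ⊥-elim (loopless wu e)
    inj {2F} {1F} e = ⊥-elim (loopless vw (≡.sym e))
    inj {2F} {2F} _ = refl
  ... | s≤s (s≤s (s≤s ()))

  toFin₂ : Bool → Fin 2
  toFin₂ false = 0F
  toFin₂ true  = 1F

  toFin₂-injective : ∀ {a b} → toFin₂ a ≡ toFin₂ b → a ≡ b
  toFin₂-injective {false} {false} _ = refl
  toFin₂-injective {true} {true} _ = refl

  monochromatic-edge : ¬ Colourable H 2 → (c : Fin h → Bool) → ∃₂ λ u v → adj H u v ≡ true × c u ≡ c v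
  monochromatic-edge ¬col c
    with any? (λ u → any? λ v → (adj H u v Bool.≟ true) ×-dec (c u Bool.≟ c v))
  ... | yes r = r
  ... | no ¬r = ⊥-elim (¬col (toFin₂ ∘ c , λ u v e eq → ¬r (u , v , e , toFin₂-injective eq)))

module _ {h} (H : Graph h) {x y : Fin h} (xy-edge : adj H x y ≡ true) where

  removeEdge-colouring : ChromaticNumber< (removeEdge H x y) 3 →
    ∃ λ (c : Fin h → Bool) → ∀ u v → adj H u v ≡ true → (u ≡ x × v ≡ y) ⊎ (u ≡ y × v ≡ x) ⊎ c u ≢ c v
  removeEdge-colouring (j , j<3 , k , proper) = isZero ∘ k , prop
    where
    isZero : ∀ {j} → Fin j → Bool
    isZero zero = true
    isZero (suc _) = false
    isZero-injective : ∀ {j} → j < 3 → (a b : Fin j) → isZero a ≡ isZero b → a ≡ b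
    isZero-injective {1} _ 0F 0F _ = refl
    isZero-injective {2} _ 0F 0F _ = refl
    isZero-injective {2} _ 1F 1F _ = refl
    isZero-injective {suc (suc (suc _))} (s≤s (s≤s (s≤s ()))) _ _ _
    prop : ∀ u v → adj H u v ≡ true → (u ≡ x × v ≡ y) ⊎ (u ≡ y × v ≡ x) ⊎ isZero (k u) ≢ isZero (k v)
    -- These are the four decisions inside `removeEdge`; once they are resolved, its adjacency
    -- reduces to `adj H u v ∧ true` in all cases other than the removed edge.
    prop u v e with u Fin.≟ x | v Fin.≟ y | u Fin.≟ y | v Fin.≟ x | proper u v
    ... | yes p | yes q | _     | _     | _ = inj₁ (p , q)
    ... | yes _ | no _  | yes p | yes q | _ = inj₂ (inj₁ (p , q))
    ... | no _  | _     | yes p | yes q | _ = inj₂ (inj₁ (p , q))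
    ... | yes _ | no _  | yes _ | no _  | f = inj₂ (inj₂ (f (cong (_∧ true) e) ∘ isZero-injective j<3 _ _))
    ... | yes _ | no _  | no _  | _     | f = inj₂ (inj₂ (f (cong (_∧ true) e) ∘ isZero-injective j<3 _ _))
    ... | no _  | _     | yes _ | no _  | f = inj₂ (inj₂ (f (cong (_∧ true) e) ∘ isZero-injective j<3 _ _))
    ... | no _  | _     | no _  | _     | f = inj₂ (inj₂ (f (cong (_∧ true) e) ∘ isZero-injective j<3 _ _))

  module _ (△ : ∀ {u v w} → adj H u v ≡ true → adj H v w ≡ true → adj H w u ≡ true → ⊥)
           (c : Fin h → Bool) (cx≡cy : c x ≡ c y)
           (proper : ∀ u v → adj H u v ≡ true → (u ≡ x × v ≡ y) ⊎ (u ≡ y × v ≡ x) ⊎ c u ≢ c v) where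
    open Derivation H x y

    x≢y : x ≢ y
    x≢y = loopless H xy-edge

    -- Vertices on the side of x and y, and vertices on the other side, are placed separately.
    module Placement {l} (near-side far-side : Fin h → Fin (suc l)) where

      place : Fin h → Place l
      place w = if does (w Fin.≟ x) then apexˣ else if does (w Fin.≟ y) then apexʸ else
                if does (c w Bool.≟ c x) then inner (near-side w) else inner (far-side w)

      place-x : place x ≡ apexˣ
      place-x rewrite dec-true (x Fin.≟ x) refl = refl

      place-y : place y ≡ apexʸ
      place-y rewrite dec-false (y Fin.≟ x) (x≢y ∘ ≡.sym) | dec-true (y Fin.≟ y) refl = refl

      place-near : ∀ {w} → w ≢ x → w ≢ y → c w ≡ c x → place w ≡ inner (near-side w)
      place-near {w} nx ny e
        rewrite dec-false (w Fin.≟ x) nx | dec-false (w Fin.≟ y) ny | dec-true (c w Bool.≟ c x) e = refl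

      place-far : ∀ {w} → c w ≢ c x → place w ≡ inner (far-side w)
      place-far {w} n
        rewrite dec-false (w Fin.≟ x) (n ∘ cong c) | dec-false (w Fin.≟ y) (λ e → n (trans (cong c e) (≡.sym cx≡cy)))
              | dec-false (c w Bool.≟ c x) n = refl

      onlyˣ : ∀ w → place w ≡ apexˣ → w ≡ x
      onlyˣ w e with w Fin.≟ x
      ... | yes p = p
      ... | no _ with w Fin.≟ y
      ...   | yes _ = case e of λ ()
      ...   | no _ with c w Bool.≟ c x
      onlyˣ w () | no _ | no _ | yes _
      onlyˣ w () | no _ | no _ | no _

      onlyʸ : ∀ w → place w ≡ apexʸ → w ≡ y
      onlyʸ w e with w Fin.≟ x
      ... | yes _ = case e of λ ()
      ... | no _ with w Fin.≟ y
      ...   | yes p = p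
      ...   | no _ with c w Bool.≟ c x
      onlyʸ w () | no _ | no _ | yes _
      onlyʸ w () | no _ | no _ | no _

      module _ (x-far : ∀ {w} → adj H x w ≡ true → c w ≢ c x → far-side w ≡ zero)
               (y-far : ∀ {w} → adj H y w ≡ true → c w ≢ c x → far-side w ≡ Fin.fromℕ l)
               (near-far : ∀ {v w} → v ≢ x → v ≢ y → adj H v w ≡ true → c v ≡ c x → c w ≢ c x →
                           Near {l} (inner (near-side v)) (inner (far-side w))) where

        near′ : ∀ v w → adj H v w ≡ true → c v ≡ c x → c w ≢ c x → Near (place v) (place w)
        near′ v w e cv cw = go (v Fin.≟ x) (v Fin.≟ y)
          where
          go : Dec (v ≡ x) → Dec (v ≡ y) → Near (place v) (place w)
          go (yes refl) _ = subst₂ Near (≡.sym place-x)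
            (≡.sym (trans (place-far cw) (cong inner (x-far e cw)))) (inj₁ first)
          go (no _) (yes refl) = subst₂ Near (≡.sym place-y)
            (≡.sym (trans (place-far cw) (cong inner (y-far e cw)))) (inj₂ last)
          go (no nx) (no ny) = subst₂ Near (≡.sym (place-near nx ny cv)) (≡.sym (place-far cw))
            (near-far nx ny e cv cw)

        near : ∀ v w → adj H v w ≡ true → Near (place v) (place w)
        near v w e = go (proper v w e) (c v Bool.≟ c x)
          where
          go : (v ≡ x × w ≡ y) ⊎ (v ≡ y × w ≡ x) ⊎ c v ≢ c w → Dec (c v ≡ c x) → Near (place v) (place w)
          go (inj₁ (refl , refl)) _ = subst₂ Near (≡.sym place-x) (≡.sym place-y) (inj₁ xy)
          go (inj₂ (inj₁ (refl , refl))) _ = subst₂ Near (≡.sym place-y) (≡.sym place-x) (inj₂ xy)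
          go (inj₂ (inj₂ n)) (yes cv) = near′ v w e cv λ cw → n (trans cv (≡.sym cw))
          go (inj₂ (inj₂ n)) (no cv) = swap (near′ w v (adj-sym H e) (≢⇒≡ (n ∘ ≡.sym) (cv ∘ ≡.sym)) cv)

        cycleMap : CycleMap l
        cycleMap = record
          { place = place ; place-x = place-x ; place-y = place-y
          ; onlyˣ = onlyˣ ; onlyʸ = onlyʸ ; near = near }

    -- The side of x and y goes to the middle place, and the other side is split by adjacency to x.
    -- No neighbour of y is adjacent to x, as `H` is triangle-free.
    cycleMap₅ : CycleMap 2
    cycleMap₅ = cycleMap
      (λ e _ → cong (λ b → if b then 0F else 2F) e)
      (λ {w} e _ → cong (λ b → if b then 0F else 2F) (¬-not λ e′ → △ e′ (adj-sym H e) (adj-sym H xy-edge)))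
      near-far
      where
      far : Fin h → Fin 3
      far w = if adj H x w then 0F else 2F
      open Placement {2} (λ _ → 1F) far
      near-far : ∀ {v w} → v ≢ x → v ≢ y → adj H v w ≡ true → c v ≡ c x → c w ≢ c x → Near (inner 1F) (inner (far w))
      near-far {w = w} _ _ _ _ _ with adj H x w
      ... | true = inj₂ (next 0F)
      ... | false = inj₁ (next 1F)

    -- On the far side, neighbours of x, neighbours of y and the rest go to 0, 4 and 2; on the near
    -- side, vertices with a common neighbour with x go to 1 and the others to 3. An edge between
    -- places 1 and 4 would complete a walk of length 4 from x to y.
    cycleMap₇ : (∀ {p q r} → adj H x p ≡ true → adj H p q ≡ true → adj H q r ≡ true → adj H r y ≡ true → ⊥) →
                CycleMap 4
    cycleMap₇ no-path = cycleMap
      (λ {w} e _ → far-x w e)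
      (λ {w} e _ → far-y w (¬-not λ e′ → △ e′ (adj-sym H e) (adj-sym H xy-edge)) e)
      near-far
      where
      close? : ∀ w → Dec (∃ λ z → adj H x z ≡ true × adj H z w ≡ true)
      close? w = any? λ z → (adj H x z Bool.≟ true) ×-dec (adj H z w Bool.≟ true)
      near-side : Fin h → Fin 5
      near-side w = if does (close? w) then 1F else 3F
      far : Fin h → Fin 5
      far w = if adj H x w then 0F else if adj H y w then 4F else 2F
      far-x : ∀ w → adj H x w ≡ true → far w ≡ 0F
      far-x w e rewrite e = refl
      far-y : ∀ w → adj H x w ≡ false → adj H y w ≡ true → far w ≡ 4F
      far-y w e e′ rewrite e | e′ = refl
      open Placement {4} near-side far
      near-far : ∀ {v w} → v ≢ x → v ≢ y → adj H v w ≡ true → c v ≡ c x → c w ≢ c x →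
                 Near (inner (near-side v)) (inner (far w))
      near-far {v} {w} _ _ vw _ _ with close? v | adj H x w in xw | adj H y w in yw
      ... | yes _ | true  | _ = inj₂ (next 0F)
      ... | no ¬z | true  | _ = ⊥-elim (¬z (w , xw , adj-sym H vw))
      ... | yes (z , xz , zv) | false | true = ⊥-elim (no-path xz zv vw (adj-sym H yw))
      ... | no _  | false | true = inj₁ (next 3F)
      ... | yes _ | false | false = inj₁ (next 1F)
      ... | no _  | false | false = inj₂ (next 2F)

    derivation : ¬ Colourable H 2 → Der []
    derivation ¬col
      with any? (λ p → any? λ q → any? λ r → (adj H x p Bool.≟ true) ×-dec (adj H p q Bool.≟ true)
                                      ×-dec (adj H q r Bool.≟ true) ×-dec (adj H r y Bool.≟ true))
    ... | yes (p , q , r , xp , pq , qr , ry) =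
      derivation₅ H x y cycleMap₅ (lookup (x ∷ p ∷ q ∷ r ∷ y ∷ []))
        λ { 0F → xp ; 1F → pq ; 2F → qr ; 3F → ry ; 4F → adj-sym H xy-edge }
    ... | no ¬path =
      derivation₇ H x y (cycleMap₇ λ xp pq qr ry → ¬path (_ , _ , _ , xp , pq , qr , ry)) (monochromatic-edge H ¬col)

-- If x and y had different colours, the 2-colouring of `H` minus xy would be proper on `H`,
-- contrary to χ = 3.
critical-derivation : ∀ {h} (H : Graph h) → ChromaticNumber≡ H 3 → OddGirth≥ H 5 →
  ∀ {x y} → adj H x y ≡ true → ChromaticNumber< (removeEdge H x y) 3 → Derivation.Der H x y []
critical-derivation H (_ , ¬col) og {x} {y} e col with removeEdge-colouring H e col
... | c , proper with c x Bool.≟ c y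
...   | yes eq = derivation H e (triangle-free H og) c eq proper (¬col 2 (s≤s (s≤s (s≤s z≤n))))
...   | no neq with monochromatic-edge H (¬col 2 (s≤s (s≤s (s≤s z≤n)))) c
...     | u , v , uv , eq with proper u v uv
...       | inj₁ (refl , refl) = ⊥-elim (neq eq)
...       | inj₂ (inj₁ (refl , refl)) = ⊥-elim (neq (≡.sym eq))
...       | inj₂ (inj₂ n) = ⊥-elim (n eq)

-- Soundness of derivations

module Eq = ≡.≡-Reasoning

module _ {h n} (H : Graph h) (G : Graph n) where

  IsHom : (Fin h → Fin n) → Set
  IsHom g = ∀ u v → adj H u v ≡ true → adj G (g u) (g v) ≡ true

  isHom? : ∀ g → Dec (IsHom g)
  isHom? g = all? λ u → all? λ v → (adj H u v Bool.≟ true) →-dec (adj G (g u) (g v) Bool.≟ true)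

-- This is k to the power 2^m, the loss after m applications of Cauchy-Schwarz.
repeatedSquare : ℕ → ℕ → ℕ
repeatedSquare zero    k = k
repeatedSquare (suc m) k = repeatedSquare m k * repeatedSquare m k

half : ∀ {a} k b c → a ≤ k * (b + c) → a ≤ k * 2 * b ⊎ a ≤ k * 2 * c
half {a} k b c le = go (≤-total b c)
  where
  double : ∀ k c → k * (c + c) ≡ k * 2 * c
  double = solve-∀
  go : b ≤ c ⊎ c ≤ b → a ≤ k * 2 * b ⊎ a ≤ k * 2 * c
  go (inj₁ b≤c) = inj₂ (≤-trans le (≤-trans (*-monoʳ-≤ k (+-monoˡ-≤ c b≤c)) (≤-reflexive (double k c))))
  go (inj₂ c≤b) = inj₁ (≤-trans le (≤-trans (*-monoʳ-≤ k (+-monoʳ-≤ b c≤b)) (≤-reflexive (double k b))))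

ind-≤1 : ∀ b → ind b ≤ 1
ind-≤1 true = ≤-refl
ind-≤1 false = z≤n

ind≢0 : ∀ {b} → ind b ≢ 0 → b ≡ true
ind≢0 {true} _ = refl
ind≢0 {false} n = ⊥-elim (n refl)

-- If s of the four hold, this is s ≤ 1 + s(s - 1)/2. The factors 1 match the shape of `joint`.
four-indicators : ∀ a b c d → ind a + (ind b + (ind c + ind d)) ≤
  1 + (ind a * (ind b * 1) + (ind a * (ind c * 1) + (ind a * (ind d * 1) +
      (ind b * (ind c * 1) + (ind b * (ind d * 1) + ind c * (ind d * 1))))))
four-indicators true  true  true  true  = m≤n+m 4 3
four-indicators true  true  true  false = m≤n+m 3 1
four-indicators true  true  false true  = m≤n+m 3 1
four-indicators true  true  false false = ≤-refl
four-indicators true  false true  true  = m≤n+m 3 1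
four-indicators true  false true  false = ≤-refl
four-indicators true  false false true  = ≤-refl
four-indicators true  false false false = ≤-refl
four-indicators false true  true  true  = m≤n+m 3 1
four-indicators false true  true  false = ≤-refl
four-indicators false true  false true  = ≤-refl
four-indicators false true  false false = ≤-refl
four-indicators false false true  true  = ≤-refl
four-indicators false false true  false = ≤-refl
four-indicators false false false true  = ≤-refl
four-indicators false false false false = z≤n

module Constants {h} (H : Graph h) (x y : Fin h) where
  open Derivation H x y

  varBound : ∀ {E} → Der E → ℕ
  varBound (ext p _ _ _ d) = p ⊔ varBound d
  varBound (four p _ _ _ _ _ _ a b c d e f) =
    p ⊔ (varBound a ⊔ (varBound b ⊔ (varBound c ⊔ (varBound d ⊔ (varBound e ⊔ varBound f)))))
  varBound (global _ _) = 0
  varBound (rooted _ _ _ _ _ _ _ _ _) = 0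

  -- Follows the recursion of `sound`: `k` is the inverse density of the current facts. The
  -- constants of the branches are added because the branch taken depends on `G`, while the total
  -- must not.
  constant : ℕ → ∀ {E} → Der E → ℕ → ℕ
  constant q (ext _ _ _ _ d) k = constant q d (k * (4 * q))
  constant q (four p _ _ _ _ _ _ a b c d e f) k =
    constant q a k₁ + (constant q b (k₁ * 2) + (constant q c (k₁ * 2 * 2) +
    (constant q d (k₁ * 2 * 2 * 2) + (constant q e (k₁ * 2 * 2 * 2 * 2) + constant q f (k₁ * 2 * 2 * 2 * 2)))))
    where k₁ = k * q * 2
  constant q (global _ _) k = repeatedSquare h k
  constant q (rooted _ _ _ _ _ _ _ _ _) k = repeatedSquare h k

-- `min-degree` is the bound (1 + 1/q)n/4 cleared of denominators.
module Soundness {h} (H : Graph h) (x y : Fin h) {n} .{{_ : NonZero n}} (G : Graph n)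
  (f : Fin h → Fin n) (f-hom : IsHom H G f) (q : ℕ)
  (min-degree : ∀ v → suc q * n ≤ 4 * q * ∑ vertices (λ u → ind (adj G v u))) (D′ : ℕ) where

  open Derivation H x y
  open Constants H x y

  D : ℕ
  D = suc D′

  Env : Set
  Env = Vec (Fin n) D

  V : List (Fin n)
  V = vertices

  Envs : List Env
  Envs = vecs D

  -- Reduction modulo `D` makes this total; it is injective on the variables below `D`.
  slot : ℕ → Fin D
  slot p = Fin.fromℕ< (m%n<n p D)

  slot-≢ : ∀ {p q} → q < p → p < D → slot q ≢ slot p
  slot-≢ {p} {q} q<p p<D e = <-irrefl eq q<p
    where
    eq : q ≡ p
    eq = Eq.begin
      q              Eq.≡⟨ m<n⇒m%n≡m (<-trans q<p p<D) ⟨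
      q % D          Eq.≡⟨ toℕ-fromℕ< (m%n<n q D) ⟨
      toℕ (slot q)   Eq.≡⟨ cong toℕ e ⟩
      toℕ (slot p)   Eq.≡⟨ toℕ-fromℕ< (m%n<n p D) ⟩
      p % D          Eq.≡⟨ m<n⇒m%n≡m p<D ⟩
      p              Eq.∎

  ⟦_⟧ : Tm → Env → Fin n
  ⟦ root u ⟧ ρ = f u
  ⟦ var p ⟧  ρ = lookup ρ (slot p)

  α : Fin n → Fin n → ℕ
  α u v = ind (adj G u v)

  hold : Facts → Env → ℕ
  hold []            ρ = 1
  hold ((p , t) ∷ E) ρ = α (⟦ t ⟧ ρ) (⟦ var p ⟧ ρ) * hold E ρ

  count : Facts → ℕ
  count E = ∑ Envs (hold E)

  ⟦⟧-fresh : ∀ {p v} ρ t → p < D → Below p t → ⟦ t ⟧ (ρ [ slot p ]≔ v) ≡ ⟦ t ⟧ ρ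
  ⟦⟧-fresh ρ (root u) p<D b = refl
  ⟦⟧-fresh {v = v} ρ (var q) p<D b = lookup∘update′ (slot-≢ b p<D) ρ v

  hold-fresh : ∀ {p v} ρ E → p < D → Fresh p E → hold E (ρ [ slot p ]≔ v) ≡ hold E ρ
  hold-fresh ρ [] p<D fr = refl
  hold-fresh ρ ((q , t) ∷ E) p<D ((bq , bt) ∷ fr) =
    cong₂ _*_ (cong₂ α (⟦⟧-fresh ρ t p<D bt) (⟦⟧-fresh ρ (var q) p<D bq)) (hold-fresh ρ E p<D fr)

  joint : List Tm → Env → Fin n → ℕ
  joint []       ρ v = 1
  joint (t ∷ ts) ρ v = α (⟦ t ⟧ ρ) v * joint ts ρ v

  new : ℕ → List Tm → Facts → Facts
  new p []       E = E
  new p (t ∷ ts) E = (p , t) ∷ new p ts E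

  hold-new : ∀ {p} v ρ ts E → p < D → All (Below p) ts → Fresh p E →
             hold (new p ts E) (ρ [ slot p ]≔ v) ≡ joint ts ρ v * hold E ρ
  hold-new v ρ [] E p<D bs fr = trans (hold-fresh ρ E p<D fr) (≡.sym (+-identityʳ _))
  hold-new {p} v ρ (t ∷ ts) E p<D (b ∷ bs) fr = trans
    (cong₂ _*_ (cong₂ α (⟦⟧-fresh ρ t p<D b) (lookup∘update (slot p) ρ v)) (hold-new v ρ ts E p<D bs fr))
    (≡.sym (*-assoc (α (⟦ t ⟧ ρ) v) (joint ts ρ v) (hold E ρ)))

  -- Neither `E` nor `ts` depends on the slot of the fresh variable, so resampling this slot by
  -- `∑-update` separates the new facts from the old.
  count-new : ∀ {p} ts E → p < D → All (Below p) ts → Fresh p E →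
              n * count (new p ts E) ≡ ∑ Envs (λ ρ → ∑ V (joint ts ρ) * hold E ρ)
  count-new {p} ts E p<D bs fr = Eq.begin
    n * count (new p ts E)
      Eq.≡⟨ ∑-update (slot p) (hold (new p ts E)) ⟨
    ∑ Envs (λ ρ → ∑ V (λ v → hold (new p ts E) (ρ [ slot p ]≔ v)))
      Eq.≡⟨ ∑-cong Envs (λ ρ → ∑-cong V (λ v → hold-new v ρ ts E p<D bs fr)) ⟩
    ∑ Envs (λ ρ → ∑ V (λ v → joint ts ρ v * hold E ρ))
      Eq.≡⟨ ∑-cong Envs (λ ρ → ∑-*ʳ V (hold E ρ) (joint ts ρ)) ⟩
    ∑ Envs (λ ρ → ∑ V (joint ts ρ) * hold E ρ) Eq.∎

  weighted : ∀ c E (W : Env → ℕ) {m} → (∀ ρ → n ≤ c * W ρ) → n * m ≡ ∑ Envs (λ ρ → W ρ * hold E ρ) →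
             count E ≤ c * m
  weighted c E W {m} le eq = *-cancelˡ-≤ n (begin
    n * count E                                    ≡⟨ ∑-*ˡ Envs n (hold E) ⟨
    ∑ Envs (λ ρ → n * hold E ρ)                ≤⟨ ∑-mono Envs (λ ρ → *-monoˡ-≤ (hold E ρ) (le ρ)) ⟩
    ∑ Envs (λ ρ → c * W ρ * hold E ρ)          ≡⟨ ∑-cong Envs (λ ρ → *-assoc c (W ρ) (hold E ρ)) ⟩
    ∑ Envs (λ ρ → c * (W ρ * hold E ρ))        ≡⟨ ∑-*ˡ Envs c (λ ρ → W ρ * hold E ρ) ⟩
    c * ∑ Envs (λ ρ → W ρ * hold E ρ)          ≡⟨ cong (c *_) eq ⟨
    c * (n * m)                                    ≡⟨ x∙yz≈y∙xz c n m ⟩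
    n * (c * m)                                    ∎)
    where
    open ≤-Reasoning

  degree-bound : ∀ v → n ≤ 4 * q * ∑ V (α v)
  degree-bound v = ≤-trans (m≤m+n n (q * n)) (min-degree v)

  count-ext : ∀ {p} t E → p < D → Below p t → Fresh p E → count E ≤ 4 * q * count ((p , t) ∷ E)
  count-ext t E p<D b fr = weighted (4 * q) E (λ ρ → ∑ V (joint (t ∷ []) ρ))
    (λ ρ → subst (λ s → n ≤ 4 * q * s) (∑-cong V λ v → ≡.sym (*-identityʳ (α (⟦ t ⟧ ρ) v))) (degree-bound (⟦ t ⟧ ρ)))
    (count-new (t ∷ []) E p<D (b ∷ []) fr)

  ∑₆ : ∀ {A : Set} → A → A → A → A → (A → A → ℕ) → ℕ
  ∑₆ a b c d F = F a b + (F a c + (F a d + (F b c + (F b d + F c d))))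

  ∑-∑₆ : ∀ {A B : Set} (xs : List B) (a b c d : A) (F : A → A → B → ℕ) →
         ∑ xs (λ z → ∑₆ a b c d (λ s t → F s t z)) ≡ ∑₆ a b c d (λ s t → ∑ xs (F s t))
  ∑-∑₆ xs a b c d F =
    trans (∑-+ xs (F a b) _) (cong (∑ xs (F a b) +_)
    (trans (∑-+ xs (F a c) _) (cong (∑ xs (F a c) +_)
    (trans (∑-+ xs (F a d) _) (cong (∑ xs (F a d) +_)
    (trans (∑-+ xs (F b c) _) (cong (∑ xs (F b c) +_) (∑-+ xs (F b d) (F c d)))))))))

  ∑₆-*ʳ : ∀ {A : Set} (a b c d : A) F m → ∑₆ a b c d (λ s t → F s t * m) ≡ ∑₆ a b c d F * m
  ∑₆-*ʳ a b c d F m = go m (F a b) (F a c) (F a d) (F b c) (F b d) (F c d)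
    where
    go : ∀ n a b c d e f → a * n + (b * n + (c * n + (d * n + (e * n + f * n)))) ≡
         (a + (b + (c + (d + (e + f))))) * n
    go = solve-∀

  -- The four degrees sum to at least n + n/q, while each vertex v adds at most one more to this sum
  -- than the number of pairs having v as a common neighbour. Hence these numbers sum to at least
  -- n/q.
  codegree-bound : ∀ a b c d → n ≤ q * ∑ V (λ v → ∑₆ a b c d (λ s t → α s v * (α t v * 1)))
  codegree-bound a b c d = *-cancelˡ-≤ 4 (+-cancelʳ-≤ (4 * (q * n)) (4 * n) (4 * (q * S)) (begin
    4 * n + 4 * (q * n)                                      ≡⟨ lhs n q ⟩
    suc q * n + (suc q * n + (suc q * n + suc q * n))
      ≤⟨ +-mono-≤ (min-degree a) (+-mono-≤ (min-degree b) (+-mono-≤ (min-degree c) (min-degree d))) ⟩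
    4 * q * δ a + (4 * q * δ b + (4 * q * δ c + 4 * q * δ d)) ≡⟨ factor (4 * q) (δ a) (δ b) (δ c) (δ d) ⟩
    4 * q * (δ a + (δ b + (δ c + δ d)))                      ≡⟨ cong (4 * q *_) sums ⟨
    4 * q * ∑ V (λ v → α a v + (α b v + (α c v + α d v)))
      ≤⟨ *-monoʳ-≤ (4 * q) (∑-mono V (λ v → four-indicators (adj G a v) (adj G b v) (adj G c v) (adj G d v))) ⟩
    4 * q * ∑ V (λ v → 1 + ∑₆ a b c d (λ s t → α s v * (α t v * 1)))
      ≡⟨ cong (4 * q *_) (trans (∑-+ V (λ _ → 1) (λ v → ∑₆ a b c d (λ s t → α s v * (α t v * 1))))
           (cong (_+ S) (trans (∑-vertices-const {n} 1) (*-identityʳ n)))) ⟩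
    4 * q * (n + S)                                          ≡⟨ rhs q n S ⟩
    4 * (q * S) + 4 * (q * n)                                ∎))
    where
    open ≤-Reasoning
    δ : Fin n → ℕ
    δ v = ∑ V (α v)
    S = ∑ V (λ v → ∑₆ a b c d (λ s t → α s v * (α t v * 1)))
    lhs : ∀ n q → 4 * n + 4 * (q * n) ≡ suc q * n + (suc q * n + (suc q * n + suc q * n))
    lhs = solve-∀
    factor : ∀ q a b c d → q * a + (q * b + (q * c + q * d)) ≡ q * (a + (b + (c + d)))
    factor = solve-∀
    rhs : ∀ q n S → 4 * q * (n + S) ≡ 4 * (q * S) + 4 * (q * n)
    rhs = solve-∀
    sums : ∑ V (λ v → α a v + (α b v + (α c v + α d v))) ≡ δ a + (δ b + (δ c + δ d))
    sums = trans (∑-+ V (α a) (λ v → α b v + (α c v + α d v))) (cong (δ a +_)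
           (trans (∑-+ V (α b) (λ v → α c v + α d v)) (cong (δ b +_) (∑-+ V (α c) (α d)))))

  count-four : ∀ {p} a b c d E → p < D → All (Below p) (a ∷ b ∷ c ∷ d ∷ []) → Fresh p E →
               count E ≤ q * ∑₆ a b c d (λ s t → count ((p , s) ∷ (p , t) ∷ E))
  count-four {p} a b c d E p<D (ba ∷ bb ∷ bc ∷ bd ∷ []) fr = weighted q E
    (λ ρ → ∑₆ a b c d (λ s t → ∑ V (joint (s ∷ t ∷ []) ρ)))
    (λ ρ → subst (λ s → n ≤ q * s) (∑-∑₆ V a b c d (λ s t → joint (s ∷ t ∷ []) ρ))
             (codegree-bound (⟦ a ⟧ ρ) (⟦ b ⟧ ρ) (⟦ c ⟧ ρ) (⟦ d ⟧ ρ)))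
    (Eq.begin
      n * ∑₆ a b c d (λ s t → count ((p , s) ∷ (p , t) ∷ E))
        Eq.≡⟨ distrib n _ _ _ _ _ _ ⟩
      ∑₆ a b c d (λ s t → n * count ((p , s) ∷ (p , t) ∷ E))
        Eq.≡⟨ cong₂ _+_ (pair ba bb) (cong₂ _+_ (pair ba bc) (cong₂ _+_ (pair ba bd)
               (cong₂ _+_ (pair bb bc) (cong₂ _+_ (pair bb bd) (pair bc bd))))) ⟩
      ∑₆ a b c d (λ s t → ∑ Envs (λ ρ → ∑ V (joint (s ∷ t ∷ []) ρ) * hold E ρ))
        Eq.≡⟨ ∑-∑₆ Envs a b c d (λ s t ρ → ∑ V (joint (s ∷ t ∷ []) ρ) * hold E ρ) ⟨
      ∑ Envs (λ ρ → ∑₆ a b c d (λ s t → ∑ V (joint (s ∷ t ∷ []) ρ) * hold E ρ))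
        Eq.≡⟨ ∑-cong Envs (λ ρ → ∑₆-*ʳ a b c d (λ s t → ∑ V (joint (s ∷ t ∷ []) ρ)) (hold E ρ)) ⟩
      ∑ Envs (λ ρ → ∑₆ a b c d (λ s t → ∑ V (joint (s ∷ t ∷ []) ρ)) * hold E ρ) Eq.∎)
    where
    pair : ∀ {s t} → Below p s → Below p t → n * count ((p , s) ∷ (p , t) ∷ E) ≡
           ∑ Envs (λ ρ → ∑ V (joint (s ∷ t ∷ []) ρ) * hold E ρ)
    pair {s} {t} bs bt = count-new (s ∷ t ∷ []) E p<D (bs ∷ bt ∷ []) fr
    distrib : ∀ n a b c d e f → n * (a + (b + (c + (d + (e + f))))) ≡
              n * a + (n * b + (n * c + (n * d + (n * e + n * f))))
    distrib = solve-∀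

  -- Cloning: from satisfying assignments to homomorphisms

  module _ (E : Facts) where

    -- ρ satisfies E, and still does so after replacing any of the variables ts by its clone in g.
    clones : ∀ {m} → Vec ℕ m → Vec (Fin n) m → Env → ℕ
    clones []       []      ρ = hold E ρ
    clones (t ∷ ts) (v ∷ g) ρ = clones ts g ρ * clones ts g (ρ [ slot t ]≔ v)

    cloneCount : ∀ {m} → Vec ℕ m → ℕ
    cloneCount {m} ts = ∑ (vecs m) (λ g → ∑ Envs (clones ts g))

    -- Cauchy-Schwarz over the clones `g` made so far, then `clone₁` at the slot of t for each `g`.
    cloneCount-square : ∀ {m} t (ts : Vec ℕ m) →
      n * (cloneCount ts * cloneCount ts) ≤ n ^ D * n ^ m * cloneCount (t ∷ ts)
    cloneCount-square {m} t ts = begin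
      n * (cloneCount ts * cloneCount ts)
        ≤⟨ *-monoʳ-≤ n (cauchy-schwarz (vecs m) A) ⟩
      n * (length (vecs m) * ∑ (vecs m) (λ g → A g * A g))
        ≡⟨ cong (λ l → n * (l * ∑ (vecs m) (λ g → A g * A g))) (length-vecs m) ⟩
      n * (n ^ m * ∑ (vecs m) (λ g → A g * A g))
        ≡⟨ x∙yz≈y∙xz n (n ^ m) _ ⟩
      n ^ m * (n * ∑ (vecs m) (λ g → A g * A g))
        ≡⟨ cong (n ^ m *_) (∑-*ˡ (vecs m) n (λ g → A g * A g)) ⟨
      n ^ m * ∑ (vecs m) (λ g → n * (A g * A g))
        ≤⟨ *-monoʳ-≤ (n ^ m) (∑-mono (vecs m) (λ g → clone₁ (slot t) (clones ts g))) ⟩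
      n ^ m * ∑ (vecs m) (λ g → n ^ D * B g)
        ≡⟨ cong (n ^ m *_) (∑-*ˡ (vecs m) (n ^ D) B) ⟩
      n ^ m * (n ^ D * ∑ (vecs m) B)
        ≡⟨ cong (λ s → n ^ m * (n ^ D * s)) (∑-comm (vecs m) V (λ g v → ∑ Envs (clones (t ∷ ts) (v ∷ g)))) ⟩
      n ^ m * (n ^ D * ∑ V (λ v → ∑ (vecs m) (λ g → ∑ Envs (clones (t ∷ ts) (v ∷ g)))))
        ≡⟨ cong (λ s → n ^ m * (n ^ D * s)) (∑-vecs m (λ g → ∑ Envs (clones (t ∷ ts) g))) ⟨
      n ^ m * (n ^ D * cloneCount (t ∷ ts))
        ≡⟨ assoc (n ^ m) (n ^ D) _ ⟩
      n ^ D * n ^ m * cloneCount (t ∷ ts) ∎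
      where
      open ≤-Reasoning
      A B : Vec (Fin n) m → ℕ
      A g = ∑ Envs (clones ts g)
      B g = ∑ V (λ v → ∑ Envs (clones (t ∷ ts) (v ∷ g)))
      assoc : ∀ a b c → a * (b * c) ≡ b * a * c
      assoc = solve-∀

    cloneCount-bound : ∀ {m k} (ts : Vec ℕ m) → n ^ D ≤ k * count E →
                       n ^ D * n ^ m ≤ repeatedSquare m k * cloneCount ts
    cloneCount-bound {k = k} [] le = begin
      n ^ D * 1                   ≡⟨ *-identityʳ (n ^ D) ⟩
      n ^ D                       ≤⟨ le ⟩
      k * count E                 ≡⟨ cong (k *_) (+-identityʳ (count E)) ⟨
      k * cloneCount []           ∎
      where open ≤-Reasoning
    cloneCount-bound {suc m} {k} (t ∷ ts) le = *-cancelˡ-≤ M {{m*n≢0 (n ^ D) (n ^ m) {{m^n≢0 n D}} {{m^n≢0 n m}}}} (begin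
      M * (n ^ D * (n * n ^ m))            ≡⟨ shuffle₁ n (n ^ D) (n ^ m) ⟩
      n * (M * M)                          ≤⟨ *-monoʳ-≤ n (*-mono-≤ ih ih) ⟩
      n * ((K * C) * (K * C))              ≡⟨ shuffle₂ n K C ⟩
      K * K * (n * (C * C))                ≤⟨ *-monoʳ-≤ (K * K) (cloneCount-square t ts) ⟩
      K * K * (M * cloneCount (t ∷ ts))    ≡⟨ x∙yz≈y∙xz (K * K) M _ ⟩
      M * (K * K * cloneCount (t ∷ ts))    ∎)
      where
      open ≤-Reasoning
      M = n ^ D * n ^ m
      K = repeatedSquare m k
      C = cloneCount ts
      ih : M ≤ K * C
      ih = cloneCount-bound ts le
      shuffle₁ : ∀ n a b → a * b * (a * (n * b)) ≡ n * (a * b * (a * b))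
      shuffle₁ = solve-∀
      shuffle₂ : ∀ n K C → n * ((K * C) * (K * C)) ≡ K * K * (n * (C * C))
      shuffle₂ = solve-∀

    Sat : Env → Set
    Sat ρ = hold E ρ ≢ 0

    *-≢0 : ∀ a b → a * b ≢ 0 → a ≢ 0 × b ≢ 0
    *-≢0 a b ne = (λ e → ne (cong (_* b) e)) , (λ e → ne (trans (cong (a *_) e) (*-zeroʳ a)))

    hold-≤1 : ∀ E ρ → hold E ρ ≤ 1
    hold-≤1 [] ρ = ≤-refl
    hold-≤1 ((p , t) ∷ E) ρ = *-mono-≤ (ind-≤1 (adj G (⟦ t ⟧ ρ) (⟦ var p ⟧ ρ))) (hold-≤1 E ρ)

    clones-≤1 : ∀ {m} (ts : Vec ℕ m) g ρ → clones ts g ρ ≤ 1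
    clones-≤1 []       []      ρ = hold-≤1 E ρ
    clones-≤1 (t ∷ ts) (v ∷ g) ρ = *-mono-≤ (clones-≤1 ts g ρ) (clones-≤1 ts g _)

    clones₀ : ∀ {m} (ts : Vec ℕ m) g ρ → clones ts g ρ ≢ 0 → Sat ρ
    clones₀ []       []      ρ c = c
    clones₀ (t ∷ ts) (v ∷ g) ρ c = clones₀ ts g ρ (proj₁ (*-≢0 _ _ c))

    clones₁ : ∀ {m} (ts : Vec ℕ m) g ρ → clones ts g ρ ≢ 0 →
              ∀ i → Sat (ρ [ slot (lookup ts i) ]≔ lookup g i)
    clones₁ (t ∷ ts) (v ∷ g) ρ c zero = clones₀ ts g _ (proj₂ (*-≢0 (clones ts g ρ) _ c))
    clones₁ (t ∷ ts) (v ∷ g) ρ c (suc i) = clones₁ ts g ρ (proj₁ (*-≢0 _ _ c)) i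

    -- The clone that comes first in the list is inserted first; as the slots differ, inserting the
    -- other does not erase it.
    clones₂ : ∀ {m} (ts : Vec ℕ m) g ρ → clones ts g ρ ≢ 0 → ∀ i j → i ≢ j →
              slot (lookup ts i) ≢ slot (lookup ts j) →
              ∃ λ ρ′ → Sat ρ′ × lookup ρ′ (slot (lookup ts i)) ≡ lookup g i
                              × lookup ρ′ (slot (lookup ts j)) ≡ lookup g j
    clones₂ (t ∷ ts) (v ∷ g) ρ c zero zero i≢j _ = ⊥-elim (i≢j refl)
    clones₂ (t ∷ ts) (v ∷ g) ρ c zero (suc j) _ s =
      _ , clones₁ ts g (ρ [ slot t ]≔ v) (proj₂ (*-≢0 (clones ts g ρ) _ c)) j
        , trans (lookup∘update′ s (ρ [ slot t ]≔ v) _) (lookup∘update (slot t) ρ v)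
        , lookup∘update _ (ρ [ slot t ]≔ v) _
    clones₂ (t ∷ ts) (v ∷ g) ρ c (suc i) zero _ s =
      _ , clones₁ ts g (ρ [ slot t ]≔ v) (proj₂ (*-≢0 (clones ts g ρ) _ c)) i
        , lookup∘update _ (ρ [ slot t ]≔ v) _
        , trans (lookup∘update′ (s ∘ ≡.sym) (ρ [ slot t ]≔ v) _) (lookup∘update (slot t) ρ v)
    clones₂ (t ∷ ts) (v ∷ g) ρ c (suc i) (suc j) i≢j s =
      clones₂ ts g ρ (proj₁ (*-≢0 _ _ c)) i j (i≢j ∘ cong suc) s

    fact-sound : ∀ {F p t} ρ → hold F ρ ≢ 0 → (p , t) ∈ F → adj G (⟦ t ⟧ ρ) (⟦ var p ⟧ ρ) ≡ true
    fact-sound ρ s (here refl) = ind≢0 (proj₁ (*-≢0 _ _ s))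
    fact-sound {(p , t) ∷ F} ρ s (there m) = fact-sound ρ (proj₂ (*-≢0 (α (⟦ t ⟧ ρ) (⟦ var p ⟧ ρ)) _ s)) m

    Adj-sound : ∀ {s t} ρ → Sat ρ → Adj E s t → adj G (⟦ s ⟧ ρ) (⟦ t ⟧ ρ) ≡ true
    Adj-sound ρ sat (edge e) = f-hom _ _ e
    Adj-sound ρ sat (fact m) = trans (Graph.sym G _ _) (fact-sound ρ sat m)
    Adj-sound ρ sat (fact⁻ m) = fact-sound ρ sat m

    module _ (σ : Fin h → Tm) (θ : Fin h → ℕ) (σ-adj : ∀ v w → adj H v w ≡ true → Adj E (σ v) (σ w))
             (g : Vec (Fin n) h) (g′ : Fin h → Fin n)
             (value : ∀ v → (σ v ≡ var (θ v) × g′ v ≡ lookup g v) ⊎ ∃ λ u → σ v ≡ root u × g′ v ≡ f u) where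

      -- Every vertex of `H` has its own clone, but an edge involves at most two of them, so a
      -- satisfying assignment containing these is enough.
      realise : ∀ ρ → clones (tabulate θ) g ρ ≢ 0 → IsHom H G g′
      realise ρ c v w vw = go (value v) (value w) (σ-adj v w vw)
        where
        ts = tabulate θ
        slot≡ : ∀ v → slot (lookup ts v) ≡ slot (θ v)
        slot≡ v = cong slot (lookup∘tabulate θ v)
        go : (σ v ≡ var (θ v) × g′ v ≡ lookup g v) ⊎ (∃ λ u → σ v ≡ root u × g′ v ≡ f u) →
             (σ w ≡ var (θ w) × g′ w ≡ lookup g w) ⊎ (∃ λ u → σ w ≡ root u × g′ w ≡ f u) →
             Adj E (σ v) (σ w) → adj G (g′ v) (g′ w) ≡ true
        go (inj₂ (u , eq , gv)) (inj₂ (u′ , eq′ , gw)) a rewrite eq | eq′ | gv | gw =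
          Adj-sound ρ (clones₀ ts g ρ c) a
        go (inj₁ (eq , gv)) (inj₂ (u , eq′ , gw)) a rewrite eq | eq′ | gv | gw =
          subst (λ z → adj G z (f u) ≡ true)
            (trans (cong (lookup ρ′) (≡.sym (slot≡ v))) (lookup∘update _ ρ _))
            (Adj-sound ρ′ (clones₁ ts g ρ c v) a)
          where ρ′ = ρ [ slot (lookup ts v) ]≔ lookup g v
        go (inj₂ (u , eq , gv)) (inj₁ (eq′ , gw)) a rewrite eq | eq′ | gv | gw =
          subst (λ z → adj G (f u) z ≡ true)
            (trans (cong (lookup ρ′) (≡.sym (slot≡ w))) (lookup∘update _ ρ _))
            (Adj-sound ρ′ (clones₁ ts g ρ c w) a)
          where ρ′ = ρ [ slot (lookup ts w) ]≔ lookup g w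
        go (inj₁ (eq , gv)) (inj₁ (eq′ , gw)) a rewrite eq | eq′ | gv | gw
          with slot (θ v) Fin.≟ slot (θ w)
        -- Adjacent variables in one slot would give a loop of `G`.
        ... | yes s with trans (≡.sym (Adj-sound ρ (clones₀ ts g ρ c) a))
                           (trans (cong (λ z → adj G (lookup ρ z) (lookup ρ (slot (θ w)))) s) (irrefl G _))
        ...   | ()
        go (inj₁ (eq , gv)) (inj₁ (eq′ , gw)) a | no s
          with clones₂ ts g ρ c v w (loopless H vw) (λ e → s (trans (≡.sym (slot≡ v)) (trans e (slot≡ w))))
        ... | ρ′ , sat , ev , ew =
          subst₂ (λ z z′ → adj G z z′ ≡ true)
            (trans (cong (lookup ρ′) (≡.sym (slot≡ v))) ev) (trans (cong (lookup ρ′) (≡.sym (slot≡ w))) ew)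
            (Adj-sound ρ′ sat a)

    -- For fixed `g` the sum over ρ is at most n ^ D, since `clones` is at most 1, and it vanishes
    -- unless `b g`. What remains is a count over `g` alone.
    leaf-bound : ∀ {k} (θ : Fin h → ℕ) (b : Vec (Fin n) h → Bool) →
                 (∀ g ρ → clones (tabulate θ) g ρ ≢ 0 → b g ≡ true) → n ^ D ≤ k * count E →
                 n ^ h ≤ repeatedSquare h k * ∑ (vecs h) (ind ∘ b)
    leaf-bound {k} θ b imp le = *-cancelˡ-≤ (n ^ D) {{m^n≢0 n D}} (begin
      n ^ D * n ^ h                                   ≤⟨ cloneCount-bound ts le ⟩
      K * cloneCount ts                               ≤⟨ *-monoʳ-≤ K (∑-mono (vecs h) λ g → ∑-mono Envs λ ρ → bound₁ g ρ) ⟩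
      K * ∑ (vecs h) (λ g → ∑ Envs (λ _ → ind (b g))) ≡⟨ cong (K *_) (∑-cong (vecs h) λ g → ∑-vecs-const {n} D (ind (b g))) ⟩
      K * ∑ (vecs h) (λ g → n ^ D * ind (b g))        ≡⟨ cong (K *_) (∑-*ˡ (vecs h) (n ^ D) (ind ∘ b)) ⟩
      K * (n ^ D * ∑ (vecs h) (ind ∘ b))              ≡⟨ x∙yz≈y∙xz K (n ^ D) _ ⟩
      n ^ D * (K * ∑ (vecs h) (ind ∘ b))              ∎)
      where
      open ≤-Reasoning
      ts = tabulate θ
      K = repeatedSquare h k
      bound₁ : ∀ g ρ → clones ts g ρ ≤ ind (b g)
      bound₁ g ρ with clones ts g ρ | clones-≤1 ts g ρ | imp g ρ
      ... | zero  | _ | _ = z≤n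
      ... | suc c | l | i rewrite i λ () = l

  homs : ℕ
  homs = ∑ (vecs h) (λ g → ind (does (isHom? H G (lookup g))))

  override : Fin h → Fin h → Vec (Fin n) h → Vec (Fin n) h
  override u v g = (g [ x ]≔ f u) [ y ]≔ f v

  -- A rooted homomorphism is counted once for every choice of the overwritten coordinates, which
  -- keeps both outcomes on the scale n ^ h.
  rootedHoms : Fin h → Fin h → ℕ
  rootedHoms u v = ∑ (vecs h) (λ g → ind (does (isHom? H G (lookup (override u v g)))))

  data Outcome (K : ℕ) : Set where
    many   : n ^ h ≤ K * homs → Outcome K
    manyAt : ∀ u v → adj H u v ≡ true → n ^ h ≤ K * rootedHoms u v → Outcome K

  Outcome-mono : ∀ {K L} → K ≤ L → Outcome K → Outcome L
  Outcome-mono le (many o) = many (≤-trans o (*-monoˡ-≤ homs le))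
  Outcome-mono le (manyAt u v e o) = manyAt u v e (≤-trans o (*-monoˡ-≤ (rootedHoms u v) le))

  split : ∀ k b c {K L} → n ^ D ≤ k * (b + c) → (n ^ D ≤ k * 2 * b → Outcome K) → (n ^ D ≤ k * 2 * c → Outcome L) →
          Outcome (K + L)
  split k b c {K} {L} le f g with half k b c le
  ... | inj₁ l = Outcome-mono (m≤m+n K L) (f l)
  ... | inj₂ r = Outcome-mono (m≤n+m L K) (g r)

  -- Induction on the derivation: a new variable costs a factor 4q, a pigeonhole node costs q and
  -- then 2 for each binary choice of a branch, and the leaves are handled by cloning.
  sound : ∀ {E} (d : Der E) k → varBound d < D → n ^ D ≤ k * count E → Outcome (constant q d k)
  sound {E} (ext p t b fr d) k vb le =
    sound d (k * (4 * q)) (≤-<-trans (m≤n⊔m p _) vb) (begin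
      n ^ D                                 ≤⟨ le ⟩
      k * count E                           ≤⟨ *-monoʳ-≤ k (count-ext t E (≤-<-trans (m≤m⊔n p _) vb) b fr) ⟩
      k * (4 * q * count ((p , t) ∷ E))     ≡⟨ *-assoc k (4 * q) _ ⟨
      k * (4 * q) * count ((p , t) ∷ E)     ∎)
    where open ≤-Reasoning
  sound {E} (four p t₀ t₁ t₂ t₃ bs fr d₁ d₂ d₃ d₄ d₅ d₆) k vb le =
    split k₁ (c t₀ t₁) _ le₁ (sound d₁ (k₁ * 2) (≤-<-trans (m≤m⊔n _ _) v₁)) λ r₁ →
    split (k₁ * 2) (c t₀ t₂) _ r₁ (sound d₂ (k₁ * 2 * 2) (≤-<-trans (m≤m⊔n _ _) v₂)) λ r₂ →
    split (k₁ * 2 * 2) (c t₀ t₃) _ r₂ (sound d₃ (k₁ * 2 * 2 * 2) (≤-<-trans (m≤m⊔n _ _) v₃)) λ r₃ →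
    split (k₁ * 2 * 2 * 2) (c t₁ t₂) _ r₃ (sound d₄ (k₁ * 2 * 2 * 2 * 2) (≤-<-trans (m≤m⊔n _ _) v₄)) λ r₄ →
    split (k₁ * 2 * 2 * 2 * 2) (c t₁ t₃) (c t₂ t₃) r₄
      (sound d₅ (k₁ * 2 * 2 * 2 * 2 * 2) (≤-<-trans (m≤m⊔n _ _) v₅))
      (sound d₆ (k₁ * 2 * 2 * 2 * 2 * 2) (≤-<-trans (m≤n⊔m _ _) v₅))
    where
    open ≤-Reasoning
    k₁ = k * q
    v₁ = ≤-<-trans (m≤n⊔m p _) vb
    v₂ = ≤-<-trans (m≤n⊔m (varBound d₁) _) v₁
    v₃ = ≤-<-trans (m≤n⊔m (varBound d₂) _) v₂
    v₄ = ≤-<-trans (m≤n⊔m (varBound d₃) _) v₃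
    v₅ = ≤-<-trans (m≤n⊔m (varBound d₄) _) v₄
    c : Tm → Tm → ℕ
    c s t = count ((p , s) ∷ (p , t) ∷ E)
    le₁ : n ^ D ≤ k₁ * ∑₆ t₀ t₁ t₂ t₃ c
    le₁ = begin
      n ^ D        ≤⟨ le ⟩
      k * count E  ≤⟨ *-monoʳ-≤ k (count-four t₀ t₁ t₂ t₃ E (≤-<-trans (m≤m⊔n p _) vb) bs fr) ⟩
      k * (q * _)  ≡⟨ *-assoc k q _ ⟨
      k₁ * ∑₆ t₀ t₁ t₂ t₃ c ∎
  sound {E} (global θ e) k vb le =
    many (leaf-bound E θ _ (λ g ρ c → dec-true (isHom? H G (lookup g))
      (realise E (var ∘ θ) θ e g (lookup g) (λ _ → inj₁ (refl , refl)) ρ c)) le)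
  sound {E} (rooted σ θ u v uv σx σy σ-var e) k vb le =
    manyAt u v uv (leaf-bound E θ _ (λ g ρ c → dec-true (isHom? H G (lookup (override u v g)))
      (realise E σ θ e g (lookup (override u v g)) (value g) ρ c)) le)
    where
    value : ∀ g w → (σ w ≡ var (θ w) × lookup (override u v g) w ≡ lookup g w) ⊎
                    ∃ λ z → σ w ≡ root z × lookup (override u v g) w ≡ f z
    value g w with w Fin.≟ y | w Fin.≟ x
    ... | yes refl | _ = inj₂ (v , σy , lookup∘update y (g [ x ]≔ f u) (f v))
    ... | no n | yes refl = inj₂ (u , σx , trans (lookup∘update′ n (g [ x ]≔ f u) (f v)) (lookup∘update x g (f u)))
    ... | no n | no n′ = inj₁ (σ-var w n′ n , trans (lookup∘update′ n (g [ x ]≔ f u) (f v)) (lookup∘update′ n′ g (f u)))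

-- From homomorphisms to injective copies

ind-≤ : ∀ {A : Set} {m} (d : Dec A) → (A → 1 ≤ m) → ind (does d) ≤ m
ind-≤ (yes a) f = f a
ind-≤ (no _)  f = z≤n

1≤ind : ∀ {A : Set} (d : Dec A) → A → 1 ≤ ind (does d)
1≤ind d a = ≤-reflexive (≡.sym (cong ind (dec-true d a)))

∑-false : ∀ {A : Set} (xs : List A) (b : A → Bool) → All (λ z → b z ≢ true) xs → ∑ xs (ind ∘ b) ≡ 0
∑-false [] b [] = refl
∑-false (z ∷ xs) b (n ∷ ns) with b z
... | true = ⊥-elim (n refl)
... | false = ∑-false xs b ns

∑-exclusive : ∀ {A : Set} (xs : List A) (b : A → Bool) →
              AllPairs (λ u v → b u ≡ true → b v ≢ true) xs → ∑ xs (ind ∘ b) ≤ 1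
∑-exclusive [] b [] = z≤n
∑-exclusive (z ∷ xs) b (ns ∷ ps) with b z in eq
... | true = ≤-reflexive (cong suc (∑-false xs b (All.map (λ n → n refl) ns)))
... | false = ∑-exclusive xs b ps

∑-member : ∀ {A : Set} {xs : List A} {c} F → c ∈ xs → F c ≤ ∑ xs F
∑-member F (here refl) = m≤m+n _ _
∑-member {xs = z ∷ xs} F (there m) = ≤-trans (∑-member F m) (m≤n+m _ (F z))

module _ {n : ℕ} where

  vecs-unique : ∀ m → Unique (vecs {n} m)
  vecs-unique zero    = [] ∷ []
  vecs-unique (suc m) = cartesianProductWith⁺ _∷_ ∷-injective (allFin⁺ n) (vecs-unique m)

  ∈-vecs : ∀ {m} (g : Vec (Fin n) m) → g ∈ vecs m
  ∈-vecs []      = here refl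
  ∈-vecs (v ∷ g) = ∈-cartesianProductWith⁺ _∷_ (∈-allFin v) (∈-vecs g)

  _≟ᵥ_ : ∀ {m} (g g′ : Vec (Fin n) m) → Dec (g ≡ g′)
  _≟ᵥ_ = ≡-dec Fin._≟_

  ∑-disjoint : ∀ {A : Set} {m} (cs : List A) (π : A → Vec (Fin n) m) (W : Vec (Fin n) m → ℕ) →
               AllPairs (λ c c′ → π c ≢ π c′) cs → ∑ cs (W ∘ π) ≤ ∑ (vecs m) W
  ∑-disjoint {m = m} cs π W dis = begin
    ∑ cs (W ∘ π)
      ≤⟨ ∑-mono cs (λ c → ≤-trans (≤-reflexive (self c))
           (∑-member (λ p → ind (does (π c ≟ᵥ p)) * W p) (∈-vecs (π c)))) ⟩
    ∑ cs (λ c → ∑ (vecs m) (λ p → ind (does (π c ≟ᵥ p)) * W p))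
      ≡⟨ ∑-comm cs (vecs m) (λ c p → ind (does (π c ≟ᵥ p)) * W p) ⟩
    ∑ (vecs m) (λ p → ∑ cs (λ c → ind (does (π c ≟ᵥ p)) * W p))
      ≡⟨ ∑-cong (vecs m) (λ p → ∑-*ʳ cs (W p) (λ c → ind (does (π c ≟ᵥ p)))) ⟩
    ∑ (vecs m) (λ p → ∑ cs (λ c → ind (does (π c ≟ᵥ p))) * W p)
      ≤⟨ ∑-mono (vecs m) (λ p → *-monoˡ-≤ (W p) (∑-exclusive cs (λ c → does (π c ≟ᵥ p)) (excl p))) ⟩
    ∑ (vecs m) (λ p → 1 * W p)
      ≡⟨ ∑-cong (vecs m) (λ p → *-identityˡ (W p)) ⟩
    ∑ (vecs m) W ∎
    where
    open ≤-Reasoning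
    self : ∀ c → W (π c) ≡ ind (does (π c ≟ᵥ π c)) * W (π c)
    self c rewrite dec-true (π c ≟ᵥ π c) refl = ≡.sym (*-identityˡ (W (π c)))
    excl : ∀ p → AllPairs (λ c c′ → does (π c ≟ᵥ p) ≡ true → does (π c′ ≟ᵥ p) ≢ true) cs
    excl p = AllPairs.map (λ {c} {c′} ne e e′ →
      ne (trans (does⇒ (π c ≟ᵥ p) e) (≡.sym (does⇒ (π c′ ≟ᵥ p) e′)))) dis

module _ {h n} (H : Graph h) (G : Graph n) where

  IsCopy : (Fin h → Fin n) → Set
  IsCopy g = (∀ i j → g i ≡ g j → i ≡ j) × IsHom H G g

  isCopy? : ∀ g → Dec (IsCopy g)
  isCopy? g = (all? λ i → all? λ j → (g i Fin.≟ g j) →-dec (i Fin.≟ j)) ×-dec isHom? H G g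

  copies : ℕ
  copies = ∑ (vecs h) (λ g → ind (does (isCopy? (lookup g))))

  collision : (Fin h → Fin n) → Fin h → Fin h → Bool
  collision g i j = does (¬? (i Fin.≟ j) ×-dec (g i Fin.≟ g j))

  hom-or-collision : ∀ g → ind (does (isHom? H G g)) ≤
    ind (does (isCopy? g)) + ∑ (vertices {h}) (λ i → ∑ (vertices {h}) (λ j → ind (collision g i j)))
  hom-or-collision g = ind-≤ (isHom? H G g) λ hom → go hom
    (any? λ i → any? λ j → ¬? (i Fin.≟ j) ×-dec (g i Fin.≟ g j))
    where
    go : IsHom H G g → Dec (∃₂ λ i j → i ≢ j × g i ≡ g j) → 1 ≤
         ind (does (isCopy? g)) + ∑ (vertices {h}) (λ i → ∑ (vertices {h}) (λ j → ind (collision g i j)))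
    go hom (yes (i , j , ne , eq)) = begin
      1                                                      ≤⟨ 1≤ind (¬? (i Fin.≟ j) ×-dec (g i Fin.≟ g j)) (ne , eq) ⟩
      ind (collision g i j)                                  ≤⟨ ∑-member (λ j → ind (collision g i j)) (∈-allFin j) ⟩
      ∑ vertices (λ j → ind (collision g i j))
        ≤⟨ ∑-member (λ i → ∑ vertices (λ j → ind (collision g i j))) (∈-allFin i) ⟩
      ∑ vertices (λ i → ∑ vertices (λ j → ind (collision g i j))) ≤⟨ m≤n+m _ _ ⟩
      _ ∎
      where open ≤-Reasoning
    go hom (no ¬c) = ≤-trans (1≤ind (isCopy? g) (inj , hom)) (m≤m+n _ _)
      where
      inj : ∀ i j → g i ≡ g j → i ≡ j
      inj i j e with i Fin.≟ j
      ... | yes p = p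
      ... | no ne = ⊥-elim (¬c (i , j , ne , e))

  -- A substitution that fixes the coordinates on which k is defined, to distinct values.
  module _ .{{_ : NonZero n}} (T : Vec (Fin n) h → Vec (Fin n) h) (k : Fin h → Maybe (Fin n))
           (free : ∀ {i} → k i ≡ nothing → ∀ g → lookup (T g) i ≡ lookup g i)
           (fixed : ∀ {i c} → k i ≡ just c → ∀ g → lookup (T g) i ≡ c)
           (k-injective : ∀ {i j c} → k i ≡ just c → k j ≡ just c → i ≡ j) where

    -- Moving the free coordinate i, at most one value makes it collide with j.
    collisions-at : ∀ i j → k i ≡ nothing → (b : Vec (Fin n) h → Bool) →
      (∀ g → b g ≡ true → i ≢ j × lookup (T g) i ≡ lookup (T g) j) →
      n * ∑ (vecs h) (ind ∘ b) ≤ n ^ h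
    collisions-at i j ki b sound = begin
      n * ∑ (vecs h) (ind ∘ b)                                         ≡⟨ ∑-update i (ind ∘ b) ⟨
      ∑ (vecs h) (λ g → ∑ vertices (λ v → ind (b (g [ i ]≔ v))))
        ≤⟨ ∑-mono (vecs h) (λ g → ∑-exclusive vertices _ (AllPairs.map (excl g) (allFin⁺ n))) ⟩
      ∑ (vecs h) (λ _ → 1)                                             ≡⟨ ∑-vecs-const h 1 ⟩
      n ^ h * 1                                                        ≡⟨ *-identityʳ (n ^ h) ⟩
      n ^ h                                                            ∎
      where
      open ≤-Reasoning
      other : i ≢ j → ∀ g u v → lookup (T (g [ i ]≔ u)) j ≡ lookup (T (g [ i ]≔ v)) j
      other i≢j g u v with k j in eq
      ... | just c = trans (fixed eq _) (≡.sym (fixed eq _))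
      ... | nothing = trans (free eq _) (trans (lookup∘update′ (i≢j ∘ ≡.sym) g u)
                        (≡.sym (trans (free eq _) (lookup∘update′ (i≢j ∘ ≡.sym) g v))))
      excl : ∀ g {u v} → u ≢ v → b (g [ i ]≔ u) ≡ true → b (g [ i ]≔ v) ≢ true
      excl g {u} {v} u≢v bu bv with sound _ bu | sound _ bv
      ... | i≢j , eu | _ , ev = u≢v (trans (≡.sym (at u)) (trans eu (trans (other i≢j g u v) (trans (≡.sym ev) (at v)))))
        where
        at : ∀ w → lookup (T (g [ i ]≔ w)) i ≡ w
        at w = trans (free ki _) (lookup∘update i g w)

    collisions : ∀ i j → n * ∑ (vecs h) (λ g → ind (collision (lookup (T g)) i j)) ≤ n ^ h
    collisions i j with k i in ei | k j in ej
    ... | nothing | _ = collisions-at i j ei _ (λ g e →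
            does⇒ (¬? (i Fin.≟ j) ×-dec (lookup (T g) i Fin.≟ lookup (T g) j)) e)
    ... | just _ | nothing = collisions-at j i ej _ (λ g e →
            let i≢j , eq = does⇒ (¬? (i Fin.≟ j) ×-dec (lookup (T g) i Fin.≟ lookup (T g) j)) e in i≢j ∘ ≡.sym , ≡.sym eq)
    ... | just c | just d = ≤-trans (≤-reflexive (trans (cong (n *_) none) (*-zeroʳ n))) z≤n
      where
      none : ∑ (vecs h) (λ g → ind (collision (lookup (T g)) i j)) ≡ 0
      none = ∑-false (vecs h) _ (All.universal (λ g e →
        let i≢j , eq = does⇒ (¬? (i Fin.≟ j) ×-dec (lookup (T g) i Fin.≟ lookup (T g) j)) e
        in i≢j (k-injective ei (trans ej (cong just (≡.sym (trans (≡.sym (fixed ei g)) (trans eq (fixed ej g)))))))) (vecs h))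

    -- A union bound: each of the h² ordered pairs of vertices collides for at most a 1/n fraction
    -- of all vectors.
    homs≤copies : n * ∑ (vecs h) (λ g → ind (does (isHom? H G (lookup (T g))))) ≤
                  n * ∑ (vecs h) (λ g → ind (does (isCopy? (lookup (T g))))) + h * h * n ^ h
    homs≤copies = begin
      n * ∑ (vecs h) (λ g → ind (does (isHom? H G (lookup (T g)))))
        ≤⟨ *-monoʳ-≤ n (∑-mono (vecs h) (λ g → hom-or-collision (lookup (T g)))) ⟩
      n * ∑ (vecs h) (λ g → ind (does (isCopy? (lookup (T g)))) + ∑ vertices (λ i → ∑ vertices (λ j → col i j g)))
        ≡⟨ cong (n *_) (∑-+ (vecs h) (λ g → ind (does (isCopy? (lookup (T g)))))
             (λ g → ∑ vertices (λ i → ∑ vertices (λ j → col i j g)))) ⟩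
      n * (C + ∑ (vecs h) (λ g → ∑ vertices (λ i → ∑ vertices (λ j → col i j g))))
        ≡⟨ *-distribˡ-+ n C _ ⟩
      n * C + n * ∑ (vecs h) (λ g → ∑ vertices (λ i → ∑ vertices (λ j → col i j g)))
        ≡⟨ cong (λ s → n * C + n * s) (trans (∑-comm (vecs h) vertices (λ g i → ∑ vertices (λ j → col i j g)))
             (∑-cong vertices (λ i → ∑-comm (vecs h) vertices (λ g j → col i j g)))) ⟩
      n * C + n * ∑ vertices (λ i → ∑ vertices (λ j → ∑ (vecs h) (col i j)))
        ≡⟨ cong (n * C +_) (trans (≡.sym (∑-*ˡ (vertices {h}) n (λ i → ∑ vertices (λ j → ∑ (vecs h) (col i j)))))
             (∑-cong vertices (λ i → ≡.sym (∑-*ˡ vertices n (λ j → ∑ (vecs h) (col i j)))))) ⟩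
      n * C + ∑ vertices (λ i → ∑ vertices (λ j → n * ∑ (vecs h) (col i j)))
        ≤⟨ +-monoʳ-≤ (n * C) (∑-mono vertices (λ i → ∑-mono vertices (λ j → collisions i j))) ⟩
      n * C + ∑ (vertices {h}) (λ i → ∑ (vertices {h}) (λ j → n ^ h))
        ≡⟨ cong (n * C +_) (trans (∑-cong (vertices {h}) (λ i → ∑-vertices-const {h} (n ^ h)))
             (trans (∑-vertices-const {h} (h * n ^ h)) (≡.sym (*-assoc h h (n ^ h))))) ⟩
      n * C + h * h * n ^ h ∎
      where
      open ≤-Reasoning
      C = ∑ (vecs h) (λ g → ind (does (isCopy? (lookup (T g)))))
      col : Fin h → Fin h → Vec (Fin n) h → ℕ
      col i j g = ind (collision (lookup (T g)) i j)

-- For n ≥ 2Ka the collision term is at most half of the total.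
absorb : ∀ {n N R C a} K → .{{NonZero n}} → N ≤ K * R → n * R ≤ n * C + a * N → 2 * K * a ≤ n → N ≤ 2 * K * C
absorb {n} {N} {R} {C} {a} K le col big = *-cancelˡ-≤ n (+-cancelʳ-≤ (n * N) _ _ (begin
  n * N + n * N                          ≡⟨ e₁ n N ⟩
  2 * (n * N)                            ≤⟨ *-monoʳ-≤ 2 (*-monoʳ-≤ n le) ⟩
  2 * (n * (K * R))                      ≡⟨ e₂ n K R ⟩
  2 * K * (n * R)                        ≤⟨ *-monoʳ-≤ (2 * K) col ⟩
  2 * K * (n * C + a * N)                ≡⟨ e₃ K n C a N ⟩
  n * (2 * K * C) + 2 * K * a * N        ≤⟨ +-monoʳ-≤ (n * (2 * K * C)) (*-monoˡ-≤ N big) ⟩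
  n * (2 * K * C) + n * N                ∎))
  where
  open ≤-Reasoning
  e₁ : ∀ n N → n * N + n * N ≡ 2 * (n * N)
  e₁ = solve-∀
  e₂ : ∀ n K R → 2 * (n * (K * R)) ≡ 2 * K * (n * R)
  e₂ = solve-∀
  e₃ : ∀ K n C a N → 2 * K * (n * C + a * N) ≡ n * (2 * K * C) + 2 * K * a * N
  e₃ = solve-∀

-- Charging edge-disjoint copies to edges of G

module _ {h} (H : Graph h) {x y : Fin h} (xy-edge : adj H x y ≡ true) (d : Derivation.Der H x y []) (q : ℕ) where
  open Constants H x y

  -- The first summand of `K₁` serves large n, where collisions cost a factor 2; the second bounds n
  -- ^ h for n below the threshold 2K₀h².
  K₀ K₁ : ℕ
  K₀ = constant q d 1
  K₁ = 2 * K₀ + (2 * K₀ * (h * h)) ^ h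

  module _ {n} .{{_ : NonZero n}} (G : Graph n)
    (min-degree : ∀ v → suc q * n ≤ 4 * q * ∑ vertices (λ u → ind (adj G v u))) where

    rootedCopies : Fin n → Fin n → ℕ
    rootedCopies a b = ∑ (vecs h) (λ g → ind (does (isCopy? H G (lookup ((g [ x ]≔ a) [ y ]≔ b)))))

    data Outcome′ (f : Fin h → Fin n) : Set where
      many′   : n ^ h ≤ K₁ * copies H G → Outcome′ f
      manyAt′ : ∀ u v → adj H u v ≡ true → n ^ h ≤ K₁ * rootedCopies (f u) (f v) → Outcome′ f

    2K₀≤K₁ : ∀ m → 2 * K₀ * m ≤ K₁ * m
    2K₀≤K₁ m = *-monoˡ-≤ m (m≤m+n (2 * K₀) _)

    copy⇒Outcome′ : ∀ f → IsCopy H G f → Outcome′ f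
    copy⇒Outcome′ f (f-inj , f-hom) with 2 * K₀ * (h * h) ≤? n
    -- For small n the given copy itself, with xy in its own position, is the one rooted copy
    -- required.
    ... | no small = manyAt′ x y xy-edge (begin
      n ^ h                             ≤⟨ ^-monoˡ-≤ h (<⇒≤ (≰⇒> small)) ⟩
      (2 * K₀ * (h * h)) ^ h            ≤⟨ m≤n+m _ (2 * K₀) ⟩
      K₁                                ≡⟨ *-identityʳ K₁ ⟨
      K₁ * 1
        ≤⟨ *-monoʳ-≤ K₁ (≤-trans (1≤ind (isCopy? H G (lookup g)) g-copy)
             (∑-member (λ g → ind (does (isCopy? H G (lookup ((g [ x ]≔ f x) [ y ]≔ f y)))))
               (∈-vecs (tabulate f)))) ⟩
      K₁ * rootedCopies (f x) (f y)     ∎)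
      where
      open ≤-Reasoning
      g = (tabulate f [ x ]≔ f x) [ y ]≔ f y
      g≡f : ∀ i → lookup g i ≡ f i
      g≡f i with i Fin.≟ y | i Fin.≟ x
      ... | yes refl | _ = lookup∘update y (tabulate f [ x ]≔ f x) (f y)
      ... | no ny | yes refl = trans (lookup∘update′ ny (tabulate f [ x ]≔ f x) (f y)) (lookup∘update x (tabulate f) (f x))
      ... | no ny | no nx = trans (lookup∘update′ ny (tabulate f [ x ]≔ f x) (f y))
                              (trans (lookup∘update′ nx (tabulate f) (f x)) (lookup∘tabulate f i))
      g-copy : IsCopy H G (lookup g)
      g-copy = (λ i j e → f-inj i j (trans (≡.sym (g≡f i)) (trans e (g≡f j))))
             , (λ u v e → trans (cong₂ (adj G) (g≡f u) (g≡f v)) (f-hom u v e))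
    ... | yes big = conclude (sound d 1 (n<1+n _) start)
      where
      open Soundness H x y G f f-hom q min-degree (varBound d)
      start : n ^ D ≤ 1 * count []
      start = ≤-reflexive (≡.sym (trans (*-identityˡ (count [])) (trans (∑-vecs-const {n} D 1) (*-identityʳ (n ^ D)))))
      conclude : Outcome K₀ → Outcome′ f
      conclude (many o) = many′ (≤-trans
        (absorb K₀ o (homs≤copies H G id (λ _ → nothing) (λ _ _ → refl) (λ ()) (λ ())) big) (2K₀≤K₁ _))
      conclude (manyAt u v uv o) = manyAt′ u v uv (≤-trans
        (absorb K₀ o (homs≤copies H G (override u v) k free fixed k-injective) big) (2K₀≤K₁ _))
        where
        k : Fin h → Maybe (Fin n)
        k i with i Fin.≟ y | i Fin.≟ x
        ... | yes _ | _     = just (f v)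
        ... | no _  | yes _ = just (f u)
        ... | no _  | no _  = nothing
        free : ∀ {i} → k i ≡ nothing → ∀ g → lookup (override u v g) i ≡ lookup g i
        free {i} e g with i Fin.≟ y | i Fin.≟ x
        ... | no ny | no nx = trans (lookup∘update′ ny (g [ x ]≔ f u) (f v)) (lookup∘update′ nx g (f u))
        fixed : ∀ {i c} → k i ≡ just c → ∀ g → lookup (override u v g) i ≡ c
        fixed {i} e g with i Fin.≟ y | i Fin.≟ x
        fixed refl g | yes refl | _ = lookup∘update y (g [ x ]≔ f u) (f v)
        fixed refl g | no ny | yes refl = trans (lookup∘update′ ny (g [ x ]≔ f u) (f v)) (lookup∘update x g (f u))
        k-injective : ∀ {i j c} → k i ≡ just c → k j ≡ just c → i ≡ j
        k-injective {i} {j} e e′ with i Fin.≟ y | i Fin.≟ x | j Fin.≟ y | j Fin.≟ x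
        k-injective refl e′ | yes p | _ | yes p′ | _ = trans p (≡.sym p′)
        k-injective refl e′ | no _ | yes p | no _ | yes p′ = trans p (≡.sym p′)
        k-injective refl e′ | yes _ | _ | no _ | yes _ = ⊥-elim (loopless H uv (f-inj u v (just-injective e′)))
        k-injective refl e′ | no _ | yes _ | yes _ | _ = ⊥-elim (loopless H uv (f-inj u v (just-injective (≡.sym e′))))

    weight : Vec (Fin n) 2 → ℕ
    weight (a ∷ b ∷ []) = copies H G + rootedCopies a b

    -- Summing `rootedCopies` over a and b resamples the coordinates x and y, so each copy is
    -- counted n² times, just as in the constant term of `weight`.
    ∑-weight : ∑ (vecs 2) weight ≡ 2 * (n ^ 2 * copies H G)
    ∑-weight = Eq.begin
      ∑ (vecs 2) weight
        Eq.≡⟨ trans (∑-vecs 1 weight) (∑-cong V λ a →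
                trans (∑-vecs 0 (λ p → weight (a ∷ p))) (∑-cong V λ b → +-identityʳ _)) ⟩
      ∑ V (λ a → ∑ V (λ b → T + rootedCopies a b))
        Eq.≡⟨ ∑-cong V (λ a → trans (∑-+ V (λ _ → T) (rootedCopies a))
                (cong (_+ ∑ V (rootedCopies a)) (∑-vertices-const {n} T))) ⟩
      ∑ V (λ a → n * T + ∑ V (rootedCopies a))
        Eq.≡⟨ trans (∑-+ V (λ _ → n * T) (λ a → ∑ V (rootedCopies a)))
                (cong₂ _+_ (∑-vertices-const {n} (n * T)) (∑-cong V λ a → ∑-comm V (vecs h) (λ b g → I ((g [ x ]≔ a) [ y ]≔ b)))) ⟩
      n * (n * T) + ∑ V (λ a → ∑ (vecs h) (λ g → ∑ V (λ b → I ((g [ x ]≔ a) [ y ]≔ b))))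
        Eq.≡⟨ cong (n * (n * T) +_) (∑-comm V (vecs h) (λ a g → ∑ V (λ b → I ((g [ x ]≔ a) [ y ]≔ b)))) ⟩
      n * (n * T) + ∑ (vecs h) (λ g → ∑ V (λ a → ∑ V (λ b → I ((g [ x ]≔ a) [ y ]≔ b))))
        Eq.≡⟨ cong (n * (n * T) +_) (∑-update x (λ g → ∑ V (λ b → I (g [ y ]≔ b)))) ⟩
      n * (n * T) + n * ∑ (vecs h) (λ g → ∑ V (λ b → I (g [ y ]≔ b)))
        Eq.≡⟨ cong (λ s → n * (n * T) + n * s) (∑-update y I) ⟩
      n * (n * T) + n * (n * T)
        Eq.≡⟨ e n T ⟩
      2 * (n ^ 2 * T) Eq.∎
      where
      T = copies H G
      V : List (Fin n)
      V = vertices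
      I : Vec (Fin n) h → ℕ
      I g = ind (does (isCopy? H G (lookup g)))
      e : ∀ n T → n * (n * T) + n * (n * T) ≡ 2 * (n * (n * 1) * T)
      e = solve-∀

    copy⇒weight : ∀ f → IsCopy H G f → ∃₂ λ u v → adj H u v ≡ true × n ^ h ≤ K₁ * weight (f u ∷ f v ∷ [])
    copy⇒weight f c with copy⇒Outcome′ f c
    ... | many′ o = x , y , xy-edge , ≤-trans o (*-monoʳ-≤ K₁ (m≤m+n _ _))
    ... | manyAt′ u v e o = u , v , e , ≤-trans o (*-monoʳ-≤ K₁ (m≤n+m _ _))

    toIsCopy : (c : Copy H G) → IsCopy H G (proj₁ c)
    toIsCopy (f , inj , hom) = (λ i j → inj) , hom

    -- Each copy is charged to the vertex pair of the edge given by `copy⇒weight`. Edge-disjointness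
    -- makes these pairs distinct, so the charges are bounded by the total weight.
    edge-disjoint-bound : (cs : List (Copy H G)) → AllPairs (EdgeDisjoint {H = H} {G = G}) cs →
                          length cs * n ^ h ≤ 2 * K₁ * (n ^ 2 * copies H G)
    edge-disjoint-bound cs dis = begin
      length cs * n ^ h                       ≡⟨ ∑-const cs (n ^ h) ⟨
      ∑ cs (λ _ → n ^ h)                      ≤⟨ ∑-mono cs (λ c → proj₂ (proj₂ (proj₂ (wt c)))) ⟩
      ∑ cs (λ c → K₁ * weight (π c))          ≡⟨ ∑-*ˡ cs K₁ (weight ∘ π) ⟩
      K₁ * ∑ cs (weight ∘ π)
        ≤⟨ *-monoʳ-≤ K₁ (∑-disjoint cs π weight (AllPairs.map (λ {c} {c′} → distinct c c′) dis)) ⟩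
      K₁ * ∑ (vecs 2) weight                  ≡⟨ cong (K₁ *_) ∑-weight ⟩
      K₁ * (2 * (n ^ 2 * copies H G))         ≡⟨ e K₁ (n ^ 2 * copies H G) ⟩
      2 * K₁ * (n ^ 2 * copies H G)           ∎
      where
      open ≤-Reasoning
      wt : ∀ (c : Copy H G) → ∃₂ λ u v → adj H u v ≡ true × n ^ h ≤ K₁ * weight (proj₁ c u ∷ proj₁ c v ∷ [])
      wt c = copy⇒weight (proj₁ c) (toIsCopy c)
      π : Copy H G → Vec (Fin n) 2
      π c = proj₁ c (proj₁ (wt c)) ∷ proj₁ c (proj₁ (proj₂ (wt c))) ∷ []
      distinct : ∀ c c′ → EdgeDisjoint {H = H} {G = G} c c′ → π c ≢ π c′
      distinct c c′ ed eq with wt c | wt c′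
      ... | u , v , uv , _ | u′ , v′ , uv′ , _ = ed u v u′ v′ uv uv′ (∷-injectiveˡ eq , ∷-injectiveˡ (∷-injectiveʳ eq))
      e : ∀ K m → K * (2 * m) ≡ 2 * K * m
      e = solve-∀

-- Listing the distinct copies

module _ {h n} (H : Graph h) (G : Graph n) where

  lookup-≢ : ∀ {g g′ : Vec (Fin n) h} → g ≢ g′ → ∃ λ i → lookup g i ≢ lookup g′ i
  lookup-≢ {g} {g′} ne = ¬∀⟶∃¬ h _ (λ i → lookup g i Fin.≟ lookup g′ i) λ e →
    ne (trans (≡.sym (tabulate∘lookup g)) (trans (tabulate-cong e) (tabulate∘lookup g′)))

  toCopies : ∀ gs → All (IsCopy H G ∘ lookup) gs → List (Copy H G)
  toCopies []       []                  = []
  toCopies (g ∷ gs) ((inj , hom) ∷ ps) = (lookup g , (λ {i} {j} → inj i j) , hom) ∷ toCopies gs ps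

  length-toCopies : ∀ gs ps → length (toCopies gs ps) ≡ length gs
  length-toCopies []       []       = refl
  length-toCopies (g ∷ gs) (p ∷ ps) = cong suc (length-toCopies gs ps)

  toCopies-distinct : ∀ gs ps → AllPairs _≢_ gs → AllPairs (DistinctCopies {H = H} {G = G}) (toCopies gs ps)
  toCopies-distinct []       []       []         = []
  toCopies-distinct (g ∷ gs) (p ∷ ps) (ne ∷ nes) = go gs ps ne ∷ toCopies-distinct gs ps nes
    where
    go : ∀ gs ps → All (g ≢_) gs → All (λ c → ∃ λ i → lookup g i ≢ proj₁ c i) (toCopies gs ps)
    go []       []       []       = []
    go (g′ ∷ gs) (_ ∷ ps) (n ∷ ns) = lookup-≢ n ∷ go gs ps ns

  copyList : Σ (List (Copy H G)) λ cs → AllPairs (DistinctCopies {H = H} {G = G}) cs × length cs ≡ copies H G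
  copyList = toCopies gs ps , toCopies-distinct gs ps (filter⁺ P? (vecs-unique h))
           , trans (length-toCopies gs ps) (length-filter (vecs h))
    where
    P? : ∀ g → Dec (IsCopy H G (lookup g))
    P? g = isCopy? H G (lookup g)
    gs = filter P? (vecs h)
    ps = all-filter P? (vecs h)
    length-filter : ∀ gs → length (filter P? gs) ≡ ∑ gs (λ g → ind (does (P? g)))
    length-filter [] = refl
    length-filter (g ∷ gs) with does (P? g)
    ... | true = cong suc (length-filter gs)
    ... | false = length-filter gs

-- Passage to rational densities

open import Data.Integer using (+_; -[1+_])
open import Data.Rational using (_/_)

fromℕ-mkℚ : ∀ m → fromℕ m ≡ mkℚ (+ m) 0 (Coprime.sym (Coprime.1-coprimeTo m))
fromℕ-mkℚ m = ℚ.fromℚᵘ-toℚᵘ (mkℚ (+ m) 0 _)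

fromℕ-mono : ∀ {m n} → m ≤ n → fromℕ m ℚ.≤ fromℕ n
fromℕ-mono {m} {n} le rewrite fromℕ-mkℚ m | fromℕ-mkℚ n =
  *≤* (subst₂ ℤ._≤_ (≡.sym (ℤ.*-identityʳ (+ m))) (≡.sym (ℤ.*-identityʳ (+ n))) (ℤ.+≤+ le))

fromℕ-* : ∀ m n → fromℕ (m * n) ≡ fromℕ m ℚ.* fromℕ n
fromℕ-* m n = trans (cong (_/ 1) (ℤ.pos-* m n)) (≡.sym (cong₂ ℚ._*_ (fromℕ-mkℚ m) (fromℕ-mkℚ n)))

fromℕ-positive : ∀ m .{{_ : NonZero m}} → ℚ.Positive (fromℕ m)
fromℕ-positive m = ℚ.normalize-pos m 1

toℚᵘ-fromℕ : ∀ m → toℚᵘ (fromℕ m) ≡ mkℚᵘ (+ m) 0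
toℚᵘ-fromℕ m = cong toℚᵘ (fromℕ-mkℚ m)

-- For γ = p/q in lowest terms, 1/4 < γ means q + 1 ≤ 4p by integrality, which is where the excess
-- factor 1 + 1/q comes from.
minDegree⇒ : ∀ {n} (G : Graph n) γ → (+ 1 / 4) ℚ.< γ → MinDegree≥ G γ →
  ∀ v → suc (ℚ.↧ₙ γ) * n ≤ 4 * ℚ.↧ₙ γ * ∑ vertices (λ u → ind (adj G v u))
minDegree⇒ G (mkℚ -[1+ _ ] _ _) (*<* ())
minDegree⇒ {n} G γ@(mkℚ (+ p) d _) (*<* lt) md v = begin
  suc q * n            ≤⟨ *-monoˡ-≤ n q<4p ⟩
  p * 4 * n          ≡⟨ e₁ p n ⟩
  4 * (p * n)        ≤⟨ *-monoʳ-≤ 4 le ⟩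
  4 * (deg * q)      ≡⟨ e₂ deg q ⟩
  4 * q * deg        ≡⟨ cong (4 * q *_) (length-filterᵇ (adj G v) vertices) ⟩
  4 * q * ∑ vertices (λ u → ind (adj G v u)) ∎
  where
  open ≤-Reasoning
  q = suc d
  deg = degree G v
  q<4p : q < p * 4
  q<4p = ℤ.drop‿+<+ (subst₂ ℤ._<_ (ℤ.*-identityˡ (+ q)) (≡.sym (ℤ.pos-* p 4)) lt)
  e₁ : ∀ p n → p * 4 * n ≡ 4 * (p * n)
  e₁ = solve-∀
  e₂ : ∀ a b → 4 * (a * b) ≡ 4 * b * a
  e₂ = solve-∀
  leᵘ : mkℚᵘ (+ p) d ℚᵘ.* mkℚᵘ (+ n) 0 ℚᵘ.≤ mkℚᵘ (+ deg) 0
  leᵘ = subst₂ (λ a b → mkℚᵘ (+ p) d ℚᵘ.* a ℚᵘ.≤ b) (toℚᵘ-fromℕ n) (toℚᵘ-fromℕ deg)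
    (ℚᵘ.≤-trans (ℚᵘ.≤-reflexive (ℚᵘ.≃-sym (ℚ.toℚᵘ-homo-* γ (fromℕ n)))) (ℚ.toℚᵘ-mono-≤ (md v)))
  le : p * n ≤ deg * q
  le = ℤ.drop‿+≤+ (subst₂ ℤ._≤_ l r (ℚᵘ.drop-*≤* leᵘ))
    where
    l : (+ p) ℤ.* (+ n) ℤ.* (+ 1) ≡ + (p * n)
    l = trans (ℤ.*-identityʳ _) (≡.sym (ℤ.pos-* p n))
    r : (+ deg) ℤ.* (+ suc (d * 1)) ≡ + (deg * q)
    r = trans (cong (λ z → + deg ℤ.* + suc z) (*-identityʳ d)) (≡.sym (ℤ.pos-* deg q))

abundant : ∀ (L N T c n² : ℕ) .{{_ : NonZero n²}} (μ ε : ℚ) .{{_ : ℚ.NonNegative μ}} →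
           μ ℚ.* fromℕ L ≡ 1ℚ → ε ℚ.* fromℕ n² ℚ.≤ fromℕ c → c * N ≤ L * (n² * T) → μ ℚ.* ε ℚ.* fromℕ N ℚ.≤ fromℕ T
abundant L N T c n² μ ε μL le bound = begin
  μ ℚ.* ε ℚ.* fromℕ N            ≡⟨ ℚ.*-assoc μ ε (fromℕ N) ⟩
  μ ℚ.* (ε ℚ.* fromℕ N)          ≤⟨ ℚ.*-monoˡ-≤-nonNeg μ step ⟩
  μ ℚ.* (fromℕ L ℚ.* fromℕ T)    ≡⟨ ℚ.*-assoc μ (fromℕ L) (fromℕ T) ⟨
  μ ℚ.* fromℕ L ℚ.* fromℕ T      ≡⟨ cong (ℚ._* fromℕ T) μL ⟩
  1ℚ ℚ.* fromℕ T               ≡⟨ ℚ.*-identityˡ (fromℕ T) ⟩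
  fromℕ T                    ∎
  where
  open ℚ.≤-Reasoning
  instance
    n²-pos : ℚ.Positive (fromℕ n²)
    n²-pos = fromℕ-positive n²
  commute : ∀ a b c → a ℚ.* b ℚ.* c ≡ a ℚ.* c ℚ.* b
  commute a b c = trans (ℚ.*-assoc a b c) (trans (cong (a ℚ.*_) (ℚ.*-comm b c)) (≡.sym (ℚ.*-assoc a c b)))
  step : ε ℚ.* fromℕ N ℚ.≤ fromℕ L ℚ.* fromℕ T
  step = ℚ.*-cancelʳ-≤-pos (fromℕ n²) (begin
    ε ℚ.* fromℕ N ℚ.* fromℕ n²             ≡⟨ commute ε (fromℕ N) (fromℕ n²) ⟩
    ε ℚ.* fromℕ n² ℚ.* fromℕ N             ≤⟨ ℚ.*-monoʳ-≤-nonNeg (fromℕ N) {{ℚ.nonNegative (fromℕ-mono {0} {N} z≤n)}} le ⟩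
    fromℕ c ℚ.* fromℕ N                  ≡⟨ fromℕ-* c N ⟨
    fromℕ (c * N)                    ≤⟨ fromℕ-mono bound ⟩
    fromℕ (L * (n² * T))           ≡⟨ cong fromℕ (e L n² T) ⟩
    fromℕ (L * T * n²)             ≡⟨ trans (fromℕ-* (L * T) n²) (cong (ℚ._* fromℕ n²) (fromℕ-* L T)) ⟩
    fromℕ L ℚ.* fromℕ T ℚ.* fromℕ n²       ∎)
    where
    e : ∀ a b c → a * (b * c) ≡ a * c * b
    e = solve-∀

admissible : ∀ {h} (H : Graph h) {x y : Fin h} → adj H x y ≡ true → Derivation.Der H x y [] →
             ∀ γ → (+ 1 / 4) ℚ.< γ → LinRemAdmissible H γ
admissible {suc h} H xy d γ lt = μ , ℚ.positive⁻¹ μ , abundance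
  where
  q = ℚ.↧ₙ γ
  -- The successor ensures that `L` is invertible; the bound is only weakened.
  L = suc (2 * K₁ H xy d q)
  instance
    L-pos : ℚ.Positive (fromℕ L)
    L-pos = fromℕ-positive L
    L-nonZero : ℚ.NonZero (fromℕ L)
    L-nonZero = ℚ.pos⇒nonZero (fromℕ L)
  μ : ℚ
  μ = 1/ fromℕ L
  instance
    μ-pos : ℚ.Positive μ
    μ-pos = ℚ.1/pos⇒pos (fromℕ L)
    μ-nonNeg : ℚ.NonNegative μ
    μ-nonNeg = ℚ.pos⇒nonNeg μ
  abundance : ∀ ε → 0ℚ ℚ.< ε → ∀ n (G : Graph n) → MinDegree≥ G γ → HasEdgeDisjointCopies H G (ε ℚ.* fromℕ (n ^ 2)) →
              HasCopies H G (μ ℚ.* ε ℚ.* fromℕ (n ^ suc h))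
  -- Since `H` has a vertex, 0 ^ suc h = 0 and the empty list suffices.
  abundance ε _ zero G md _ = [] , [] , ℚ.≤-reflexive (ℚ.*-zeroʳ (μ ℚ.* ε))
  abundance ε _ n@(suc _) G md (cs , dis , le) =
    let cs′ , distinct , len = copyList H G in
    cs′ , distinct , subst (λ T → μ ℚ.* ε ℚ.* fromℕ (n ^ suc h) ℚ.≤ fromℕ T) (≡.sym len)
      (abundant L (n ^ suc h) (copies H G) (length cs) (n ^ 2) {{m^n≢0 n 2}} μ ε (ℚ.*-inverseˡ (fromℕ L)) le
        (≤-trans (edge-disjoint-bound H xy d q G (minDegree⇒ G γ lt md) cs dis)
          (*-monoˡ-≤ (n ^ 2 * copies H G) (n≤1+n (2 * K₁ H xy d q)))))

theorem5p7 : ∀ {h} (H : Graph h) → ChromaticNumber≡ H 3 → HasCriticalEdge H 3 → OddGirth≥ H 5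
    → δlinrem≤ H (+ 1 / 4)
theorem5p7 H χ (x , y , xy , critical) girth s lt with ½ ℚ.<? s
-- For s above ½ the choice γ = ½ works; otherwise any γ strictly between 1/4 and s does, and γ ≤ 1
-- follows from s ≤ ½.
... | yes ½<s = ½ , *≤* (ℤ.+≤+ z≤n) , *≤* (ℤ.+≤+ (s≤s z≤n)) , ½<s
              , admissible H xy (critical-derivation H χ girth xy critical) ½ (*<* (ℤ.+<+ (s≤s (s≤s (s≤s z≤n)))))
... | no ½≮s with ℚ.<-dense lt
...   | γ , 1/4<γ , γ<s = γ
      , ℚ.<⇒≤ (ℚ.<-trans (*<* (ℤ.+<+ (s≤s z≤n))) 1/4<γ)
      , ℚ.<⇒≤ (ℚ.<-≤-trans γ<s (ℚ.≤-trans (ℚ.≮⇒≥ ½≮s) (*≤* (ℤ.+≤+ (s≤s z≤n)))))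
      , γ<s , admissible H xy (critical-derivation H χ girth xy critical) γ 1/4<γ
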